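{- Let $p$ be an odd prime, $a\in\mathbb{Z}_p$ with $a\not\equiv 0,-1\pmod p$. If $\langle a\rangle_p$ is even, then $$\sum_{k=0}^{p-1}\binom ak^2(-1)^k\Big(1-\frac 2ak\Big)\equiv (-1)^{\frac{\langle a\rangle_p}{2}}2^{2\langle a\rangle_p}\frac{a-\langle a\rangle_p}{a\binom{\langle a\rangle_p}{\langle a\rangle_p/2}}\pmod{p^2}.$$ If $\langle a\rangle_p$ is odd, then $$\sum_{k=0}^{p-1}\binom ak^2(-1)^k\Big(1-\frac 2ak\Big)\equiv \frac{a+1}{a}(-1)^{\frac{p-\langle a\rangle_p}{2}}2^{2\langle a\rangle_p+1}\binom{p-2-\langle a\rangle_p}{\frac{p-2-\langle a\rangle_p}{2}}\Big(1-2pq_p(2)+(p+a-\langle a\rangle_p)\big(H_{\langle a\rangle_p+1}-H_{\frac{\langle a\rangle_p+1}{2}}\big)\Big)\pmod{p^2}.$$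
   Context: $\mathbb{Z}_p$ denotes the set of rational numbers whose denominator is not divisible by $p$; congruences are taken in $\mathbb{Z}_p$. For $a\in\mathbb{Z}_p$, $\langle a\rangle_p$ is the unique integer in $\{0,1,\dots,p-1\}$ with $a\equiv\langle a\rangle_p\pmod p$. The general binomial coefficient is $\binom a0=1$, $\binom ak=a(a-1)\cdots(a-k+1)/k!$ for $k\ge1$. $q_p(2)=(2^{p-1}-1)/p$. $H_0=0$ and $H_n=1+\frac12+\cdots+\frac1n$ for $n\ge1$. -}

module Defs where

open import Data.Nat as ℕ using (ℕ; zero; suc)
open import Data.Nat.Divisibility using (_∣_)
open import Data.Integer using (+_)
open import Data.Rational as ℚ using (ℚ; ↧ₙ_; _+_; _*_; _-_; -_; 0ℚ; 1ℚ)
open import Data.Rational.Properties using (_≟_)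
open import Data.Product using (∃-syntax; _×_)
open import Relation.Nullary using (¬_; yes; no)
open import Relation.Binary.PropositionalEquality using (_≡_)

ℕ→ℚ : ℕ → ℚ
ℕ→ℚ n = + n ℚ./ 1

_^ℚ_ : ℚ → ℕ → ℚ
x ^ℚ zero = 1ℚ
x ^ℚ suc n = x * (x ^ℚ n)

-- total division on ℚ (x ÷₀ 0 = 0); only ever used with nonzero divisors
_÷₀_ : ℚ → ℚ → ℚ
x ÷₀ y with y ≟ 0ℚ
... | yes _ = 0ℚ
... | no y≢0 = ℚ._÷_ x y {{ℚ.≢-nonZero y≢0}}

Σ< : ℕ → (ℕ → ℚ) → ℚ
Σ< zero f = 0ℚ
Σ< (suc n) f = Σ< n f + f n

binom : ℚ → ℕ → ℚ
binom a zero = 1ℚ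
binom a (suc k) = binom a k * (a - ℕ→ℚ k) * (+ 1 ℚ./ suc k)

H : ℕ → ℚ
H zero = 0ℚ
H (suc n) = H n + (+ 1 ℚ./ suc n)

qp2 : ℕ → ℚ
qp2 p = (ℕ→ℚ (2 ℕ.^ (p ℕ.∸ 1)) - 1ℚ) ÷₀ ℕ→ℚ p

InZp : ℕ → ℚ → Set
InZp p x = ¬ (p ∣ ↧ₙ x)

_≡_[mod_^_] : ℚ → ℚ → ℕ → ℕ → Set
x ≡ y [mod p ^ k ] = ∃[ z ] (InZp p z × (x - y ≡ ℕ→ℚ (p ℕ.^ k) * z))

{-# OPTIONS --safe #-}
module Submission where

-- Since C(a,k)²(1 − 2k/a) = C(a−1,k)² − C(a−1,k−1)², the sum telescopes to 2T(a−1) modulo p², where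
-- T(b) = Σ_{k<p} (−1)ᵏ C(b,k)².  Creative telescoping gives (b+2)T(b+2) + 4(b+1)T(b) as a quadratic form
-- in C(b,p−1) and C(b,p−2), which vanishes modulo p² unless b ≡ −1 or −2 (mod p).  For even ⟨a⟩ one climbs
-- from T(1+c) ≡ −2c with p ∣ c; for odd ⟨a⟩ one descends from T(u−1) ≡ 1 − u H_{(p−1)/2} with p ∣ u,
-- and reflects the harmonic numbers through 1/j + 1/(p−j) ≡ 0 (mod p).

open import Defs
open import Data.Nat as ℕ using (ℕ; zero; suc; _<_; _≤_; _∸_; s≤s; z≤n)
open import Data.Nat.DivMod using (_/_; m*n/n≡m)
open import Data.Nat.Divisibility using (_∣_; divides; ∣-trans; m∣m*n; ∣⇒≤; ∣1⇒≡1)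
open import Data.Nat.Primality using (Prime; euclidsLemma; ¬prime[1]; prime⇒nonZero; prime⇒irreducible)
open import Data.Nat.Combinatorics using (_C_; nCk+nC[k+1]≡[n+1]C[k+1]; k>n⇒nCk≡0)
import Data.Nat.Coprimality as Coprimality
import Data.Nat.Properties as ℕₚ
import Data.Nat.Tactic.RingSolver as ℕ-Solver
open import Data.Integer as ℤ using (ℤ; +_; -[1+_]; +[1+_])
import Data.Integer.Properties as ℤₚ
import Data.Integer.Divisibility.Signed as ℤ∣
open import Data.Rational as ℚ using (ℚ; mkℚ; ↥_; ↧_; ↧ₙ_; _+_; _*_; _-_; -_; 1ℚ; 0ℚ; toℚᵘ)
import Data.Rational.Properties as ℚₚ
open import Data.Rational.Unnormalised as ℚᵘ using (mkℚᵘ; *≡*)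
import Data.Rational.Unnormalised.Properties as ℚᵘₚ
open import Data.Product using (_×_; _,_; proj₁; proj₂; ∃-syntax)
open import Data.Sum using (_⊎_; inj₁; inj₂)
open import Data.Empty using (⊥-elim)
open import Relation.Nullary using (¬_; yes; no)
open import Relation.Nullary.Decidable using (dec⇒maybe)
open import Relation.Binary.PropositionalEquality
  using (_≡_; _≢_; refl; sym; trans; cong; cong₂; subst; subst₂; module ≡-Reasoning)
open import Function using (_$_)
open import Tactic.RingSolver using (solve-∀)
open import Tactic.RingSolver.Core.AlmostCommutativeRing using (AlmostCommutativeRing; fromCommutativeRing)

open ≡-Reasoning

-- The recurrence moves the argument by 2 and cannot cross the gaps b ≡ -1, -2, so the residues
-- split into two chains, 1, 3, ..., p - 2 and 0, 2, ..., p - 1, each needing a known value of its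
-- own. The residue of a - 1 lies in the first chain when ⟨a⟩ is even and in the second when it is
-- odd. In the first chain T is divisible by p, so the step factors matter only modulo p and a plain
-- product suffices. In the second chain T need not be divisible by p, so the first-order term in
-- the p-divisible displacement has to be carried along; the harmonic numbers are the accumulated
-- logarithmic derivatives of the step factors. Descending from -1 makes the number of steps (p - 2
-- - ⟨a⟩)/2, which is the lower index of the central binomial coefficient in the claim; one further
-- step, from a + 1 to a - 1, supplies (a + 1)/a.

ℚ-ring : AlmostCommutativeRing _ _
ℚ-ring = fromCommutativeRing ℚₚ.+-*-commutativeRing (λ x → dec⇒maybe (0ℚ ℚₚ.≟ x))

-- Integers inside ℚ, denominators and division

ℤ→ℚ : ℤ → ℚ
ℤ→ℚ z = z ℚ./ 1

inv : ℕ → ℚ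
inv k = + 1 ℚ./ suc k

ℤ→ℚ-mkℚ : ∀ z → ℤ→ℚ z ≡ mkℚ z 0 (Coprimality.sym (Coprimality.1-coprimeTo ℤ.∣ z ∣))
ℤ→ℚ-mkℚ z = ℚₚ.↥p/↧p≡p (mkℚ z 0 _)

ℤ→ℚ-+ : ∀ x y → ℤ→ℚ (x ℤ.+ y) ≡ ℤ→ℚ x + ℤ→ℚ y
ℤ→ℚ-+ x y = trans
  (cong ℤ→ℚ (sym (cong₂ ℤ._+_ (ℤₚ.*-identityʳ x) (ℤₚ.*-identityʳ y))))
  (sym (cong₂ _+_ (ℤ→ℚ-mkℚ x) (ℤ→ℚ-mkℚ y)))

ℤ→ℚ-* : ∀ x y → ℤ→ℚ (x ℤ.* y) ≡ ℤ→ℚ x * ℤ→ℚ y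
ℤ→ℚ-* x y = sym (cong₂ _*_ (ℤ→ℚ-mkℚ x) (ℤ→ℚ-mkℚ y))

ℤ→ℚ-neg : ∀ x → ℤ→ℚ (ℤ.- x) ≡ - ℤ→ℚ x
ℤ→ℚ-neg (+ zero)  = refl
ℤ→ℚ-neg +[1+ n ]  = refl
ℤ→ℚ-neg -[1+ n ]  = begin
  ℤ→ℚ +[1+ n ]          ≡⟨ ℤ→ℚ-mkℚ +[1+ n ] ⟩
  mkℚ +[1+ n ] 0 _      ≡⟨ cong -_ (ℤ→ℚ-mkℚ -[1+ n ]) ⟨
  - ℤ→ℚ -[1+ n ]        ∎

ℤ→ℚ-injective : ∀ {x y} → ℤ→ℚ x ≡ ℤ→ℚ y → x ≡ y
ℤ→ℚ-injective {x} {y} eq = cong ↥_ (trans (sym (ℤ→ℚ-mkℚ x)) (trans eq (ℤ→ℚ-mkℚ y)))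

ℕ→ℚ-+ : ∀ m n → ℕ→ℚ (m ℕ.+ n) ≡ ℕ→ℚ m + ℕ→ℚ n
ℕ→ℚ-+ m n = ℤ→ℚ-+ (+ m) (+ n)

ℕ→ℚ-* : ∀ m n → ℕ→ℚ (m ℕ.* n) ≡ ℕ→ℚ m * ℕ→ℚ n
ℕ→ℚ-* m n = trans (cong ℤ→ℚ (ℤₚ.pos-* m n)) (ℤ→ℚ-* (+ m) (+ n))

ℕ→ℚ-suc : ∀ n → ℕ→ℚ (suc n) ≡ 1ℚ + ℕ→ℚ n
ℕ→ℚ-suc = ℕ→ℚ-+ 1

toℚᵘ-ℤ→ℚ : ∀ z → toℚᵘ (ℤ→ℚ z) ≡ mkℚᵘ z 0
toℚᵘ-ℤ→ℚ z = cong toℚᵘ (ℤ→ℚ-mkℚ z)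

*-inv : ∀ k → ℕ→ℚ (suc k) * inv k ≡ 1ℚ
*-inv k = ℚₚ.toℚᵘ-injective (ℚᵘₚ.≃-trans
  (ℚₚ.toℚᵘ-homo-* (ℕ→ℚ (suc k)) (inv k))
  (ℚᵘₚ.≃-trans
    (ℚᵘₚ.*-cong (ℚᵘₚ.≃-reflexive (toℚᵘ-ℤ→ℚ (+ suc k))) (ℚₚ.toℚᵘ-fromℚᵘ (mkℚᵘ (+ 1) k)))
    (*≡* (trans (ℤₚ.*-identityʳ (+ suc k ℤ.* + 1)) (trans (ℤₚ.*-identityʳ (+ suc k))
      (sym (trans (ℤₚ.*-identityˡ _) (cong +_ (ℕₚ.+-identityʳ (suc k))))))))))

↧*≡↥ : ∀ x → ℕ→ℚ (↧ₙ x) * x ≡ ℤ→ℚ (↥ x)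
↧*≡↥ x@(mkℚ u d _) = ℚₚ.toℚᵘ-injective (ℚᵘₚ.≃-trans
  (ℚₚ.toℚᵘ-homo-* (ℕ→ℚ (suc d)) x)
  (subst₂ (λ v w → v ℚᵘ.* mkℚᵘ u d ℚᵘ.≃ w) (sym (toℚᵘ-ℤ→ℚ (+ suc d))) (sym (toℚᵘ-ℤ→ℚ u))
    (*≡* (trans (ℤₚ.*-identityʳ (+ suc d ℤ.* u))
           (trans (ℤₚ.*-comm (+ suc d) u)
             (cong (u ℤ.*_) (sym (cong +_ (ℕₚ.+-identityʳ (suc d))))))))))

-- Lowest terms: n u = z d with d coprime to u forces d to divide n. Membership in ℤ_p can thus be
-- read off any representing fraction, without computing the normalised denominator of a sum or
-- product.
↧-∣ : ∀ x n z → ℕ→ℚ n * x ≡ ℤ→ℚ z → ↧ₙ x ∣ n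
↧-∣ x@(mkℚ u d c) n z eq =
  Coprimality.coprime-divisor (Coprimality.sym (Coprimality.recompute c))
    (divides ℤ.∣ z ∣ (trans (ℕₚ.*-comm ℤ.∣ u ∣ n) (trans (sym (ℤₚ.abs-* (+ n) u))
      (trans (cong ℤ.∣_∣ crossed) (ℤₚ.abs-* z (+ suc d))))))
  where
  eqᵘ : mkℚᵘ (+ n) 0 ℚᵘ.* mkℚᵘ u d ℚᵘ.≃ mkℚᵘ z 0
  eqᵘ = subst₂ (λ v w → v ℚᵘ.* mkℚᵘ u d ℚᵘ.≃ w) (toℚᵘ-ℤ→ℚ (+ n)) (toℚᵘ-ℤ→ℚ z)
    (ℚᵘₚ.≃-trans (ℚᵘₚ.≃-sym (ℚₚ.toℚᵘ-homo-* (ℕ→ℚ n) x)) (ℚₚ.toℚᵘ-cong eq))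
  crossed : + n ℤ.* u ≡ z ℤ.* + suc d
  crossed with eqᵘ
  ... | *≡* e = trans (sym (ℤₚ.*-identityʳ (+ n ℤ.* u)))
                  (trans e (cong (z ℤ.*_) (cong +_ (ℕₚ.+-identityʳ (suc d)))))

-- An exhibited inverse rules out the zero branch of `÷₀` and, inverses being unique, turns the
-- division into a multiplication.
÷₀-* : ∀ x y i → y * i ≡ 1ℚ → x ÷₀ y ≡ x * i
÷₀-* x y i y*i≡1 with y ℚₚ.≟ 0ℚ
... | yes y≡0 = ⊥-elim (0≢1 (trans (sym (ℚₚ.*-zeroˡ i)) (trans (cong (_* i) (sym y≡0)) y*i≡1)))
  where
  0≢1 : 0ℚ ≢ 1ℚ
  0≢1 ()
... | no y≢0 = cong (x *_) (begin
    y⁻¹            ≡⟨ ℚₚ.*-identityʳ y⁻¹ ⟨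
    y⁻¹ * 1ℚ       ≡⟨ cong (y⁻¹ *_) y*i≡1 ⟨
    y⁻¹ * (y * i)  ≡⟨ ℚₚ.*-assoc y⁻¹ y i ⟨
    y⁻¹ * y * i    ≡⟨ cong (_* i) (ℚₚ.*-inverseˡ y {{ℚ.≢-nonZero y≢0}}) ⟩
    1ℚ * i         ≡⟨ ℚₚ.*-identityˡ i ⟩
    i              ∎)
  where
  y⁻¹ = (ℚ.1/ y) {{ℚ.≢-nonZero y≢0}}

-- The local ring ℤ_p, its ideals and units

module Localisation (p : ℕ) (p-prime : Prime p) where

  private instance
    p-nonZero : ℕ.NonZero p
    p-nonZero = prime⇒nonZero p-prime

  -- Records rather than synonyms, so that Agda recovers x by unification.
  record Zp (x : ℚ) : Set where
    constructor zp
    field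
      inZp : InZp p x

  -- The ideal p^k ℤ_p. Congruences are handled as membership of the difference, so that they can be
  -- added and scaled termwise.
  record M (k : ℕ) (x : ℚ) : Set where
    constructor mkM
    field
      quotient   : ℚ
      quotient∈  : Zp quotient
      equality   : x ≡ ℕ→ℚ (p ℕ.^ k) * quotient

  p∤1 : ¬ (p ∣ 1)
  p∤1 p∣1 = ¬prime[1] (subst Prime (∣1⇒≡1 p∣1) p-prime)

  Zp-fromFraction : ∀ {x} n z → ¬ (p ∣ n) → ℕ→ℚ n * x ≡ ℤ→ℚ z → Zp x
  Zp-fromFraction {x} n z p∤n eq = zp λ p∣↧x → p∤n (∣-trans p∣↧x (↧-∣ x n z eq))

  p∤* : ∀ {m n} → ¬ (p ∣ m) → ¬ (p ∣ n) → ¬ (p ∣ m ℕ.* n)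
  p∤* {m} {n} p∤m p∤n p∣mn with euclidsLemma m n p-prime p∣mn
  ... | inj₁ p∣m = p∤m p∣m
  ... | inj₂ p∣n = p∤n p∣n

  Zp-ℤ : ∀ z → Zp (ℤ→ℚ z)
  Zp-ℤ z = Zp-fromFraction 1 z p∤1 (ℚₚ.*-identityˡ _)

  Zp-ℕ : ∀ n → Zp (ℕ→ℚ n)
  Zp-ℕ n = Zp-ℤ (+ n)

  p∤small : ∀ {k} → suc k < p → ¬ (p ∣ suc k)
  p∤small k<p p∣k = ℕₚ.<⇒≱ k<p (∣⇒≤ p∣k)

  Zp-inv : ∀ {k} → suc k < p → Zp (inv k)
  Zp-inv {k} k<p = Zp-fromFraction (suc k) (+ 1) (p∤small k<p) (*-inv k)

  Zp-+ : ∀ {x y} → Zp x → Zp y → Zp (x + y)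
  Zp-+ {x} {y} (zp hx) (zp hy) =
    Zp-fromFraction (↧ₙ x ℕ.* ↧ₙ y) (↥ x ℤ.* ↧ y ℤ.+ ↧ x ℤ.* ↥ y) (p∤* hx hy) (begin
      ℕ→ℚ (↧ₙ x ℕ.* ↧ₙ y) * (x + y)
        ≡⟨ cong (_* (x + y)) (ℕ→ℚ-* (↧ₙ x) (↧ₙ y)) ⟩
      dx * dy * (x + y)
        ≡⟨ expand dx dy x y ⟩
      dx * x * dy + dx * (dy * y)
        ≡⟨ cong₂ (λ u v → u * dy + dx * v) (↧*≡↥ x) (↧*≡↥ y) ⟩
      ℤ→ℚ (↥ x) * dy + dx * ℤ→ℚ (↥ y)
        ≡⟨ cong₂ _+_ (ℤ→ℚ-* (↥ x) (↧ y)) (ℤ→ℚ-* (↧ x) (↥ y)) ⟨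
      ℤ→ℚ (↥ x ℤ.* ↧ y) + ℤ→ℚ (↧ x ℤ.* ↥ y)
        ≡⟨ ℤ→ℚ-+ (↥ x ℤ.* ↧ y) (↧ x ℤ.* ↥ y) ⟨
      ℤ→ℚ (↥ x ℤ.* ↧ y ℤ.+ ↧ x ℤ.* ↥ y) ∎)
    where
    dx = ℕ→ℚ (↧ₙ x)
    dy = ℕ→ℚ (↧ₙ y)
    expand : ∀ a b x y → a * b * (x + y) ≡ a * x * b + a * (b * y)
    expand = solve-∀ ℚ-ring

  Zp-* : ∀ {x y} → Zp x → Zp y → Zp (x * y)
  Zp-* {x} {y} (zp hx) (zp hy) =
    Zp-fromFraction (↧ₙ x ℕ.* ↧ₙ y) (↥ x ℤ.* ↥ y) (p∤* hx hy) (begin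
      ℕ→ℚ (↧ₙ x ℕ.* ↧ₙ y) * (x * y)
        ≡⟨ cong (_* (x * y)) (ℕ→ℚ-* (↧ₙ x) (↧ₙ y)) ⟩
      dx * dy * (x * y)
        ≡⟨ expand dx dy x y ⟩
      dx * x * (dy * y)
        ≡⟨ cong₂ _*_ (↧*≡↥ x) (↧*≡↥ y) ⟩
      ℤ→ℚ (↥ x) * ℤ→ℚ (↥ y)
        ≡⟨ ℤ→ℚ-* (↥ x) (↥ y) ⟨
      ℤ→ℚ (↥ x ℤ.* ↥ y) ∎)
    where
    dx = ℕ→ℚ (↧ₙ x)
    dy = ℕ→ℚ (↧ₙ y)
    expand : ∀ a b x y → a * b * (x * y) ≡ a * x * (b * y)
    expand = solve-∀ ℚ-ring

  Zp-neg : ∀ {x} → Zp x → Zp (- x)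
  Zp-neg {x} (zp hx) = Zp-fromFraction (↧ₙ x) (ℤ.- ↥ x) hx (begin
    ℕ→ℚ (↧ₙ x) * - x      ≡⟨ ℚₚ.neg-distribʳ-* (ℕ→ℚ (↧ₙ x)) x ⟨
    - (ℕ→ℚ (↧ₙ x) * x)    ≡⟨ cong -_ (↧*≡↥ x) ⟩
    - ℤ→ℚ (↥ x)           ≡⟨ ℤ→ℚ-neg (↥ x) ⟨
    ℤ→ℚ (ℤ.- ↥ x)         ∎)

  Zp-- : ∀ {x y} → Zp x → Zp y → Zp (x - y)
  Zp-- hx hy = Zp-+ hx (Zp-neg hy)

  π : ℚ
  π = ℕ→ℚ p

  M-resp : ∀ {k x y} → x ≡ y → M k x → M k y
  M-resp {k} = subst (M k)

  M-0 : ∀ {k} → M k 0ℚ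
  M-0 {k} = mkM 0ℚ (Zp-ℤ (+ 0)) $ sym (ℚₚ.*-zeroʳ (ℕ→ℚ (p ℕ.^ k)))

  M-+ : ∀ {k x y} → M k x → M k y → M k (x + y)
  M-+ {k} (mkM z hz refl) (mkM w hw refl) =
    mkM (z + w) (Zp-+ hz hw) $ sym (ℚₚ.*-distribˡ-+ (ℕ→ℚ (p ℕ.^ k)) z w)

  M-neg : ∀ {k x} → M k x → M k (- x)
  M-neg {k} (mkM z hz refl) = mkM (- z) (Zp-neg hz) $ ℚₚ.neg-distribʳ-* (ℕ→ℚ (p ℕ.^ k)) z

  M-- : ∀ {k x y} → M k x → M k y → M k (x - y)
  M-- hx hy = M-+ hx (M-neg hy)

  M-*ʳ : ∀ {k x y} → M k x → Zp y → M k (x * y)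
  M-*ʳ {k} {y = y} (mkM z hz refl) hy = mkM (z * y) (Zp-* hz hy) $ ℚₚ.*-assoc (ℕ→ℚ (p ℕ.^ k)) z y

  M-*ˡ : ∀ {k x y} → Zp x → M k y → M k (x * y)
  M-*ˡ {k} {x} {y} hx hy = subst (M k) (ℚₚ.*-comm y x) (M-*ʳ hy hx)

  M-1* : ∀ {x y} → M 1 x → M 1 y → M 2 (x * y)
  M-1* (mkM z hz refl) (mkM w hw refl) = mkM (z * w) (Zp-* hz hw) (begin
    q * z * (q * w)  ≡⟨ regroup q z w ⟩
    q * q * (z * w)  ≡⟨ cong (_* (z * w)) (ℕ→ℚ-* (p ℕ.^ 1) (p ℕ.^ 1)) ⟨
    ℕ→ℚ (p ℕ.^ 1 ℕ.* p ℕ.^ 1) * (z * w)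
      ≡⟨ cong (λ n → ℕ→ℚ (n ℕ.* p ℕ.^ 1) * (z * w)) (ℕₚ.*-identityʳ p) ⟩
    ℕ→ℚ (p ℕ.^ 2) * (z * w) ∎)
    where
    q = ℕ→ℚ (p ℕ.^ 1)
    regroup : ∀ q z w → q * z * (q * w) ≡ q * q * (z * w)
    regroup = solve-∀ ℚ-ring

  M⇒Zp : ∀ {k x} → M k x → Zp x
  M⇒Zp {k} (mkM z hz refl) = Zp-* (Zp-ℕ (p ℕ.^ k)) hz

  π∈M1 : M 1 π
  π∈M1 = mkM 1ℚ (Zp-ℤ (+ 1)) $ trans (cong ℕ→ℚ (sym (ℕₚ.*-identityʳ p))) (sym (ℚₚ.*-identityʳ _))

  record Unit (x : ℚ) : Set where
    constructor mkUnit
    field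
      inverse    : ℚ
      inverse∈   : Zp inverse
      *-inverse  : x * inverse ≡ 1ℚ

  private
    p∣↥⇒M1 : ∀ x → Zp x → p ∣ ℤ.∣ ↥ x ∣ → M 1 x
    p∣↥⇒M1 x (zp hx) p∣↥x with ℤ∣.∣ᵤ⇒∣ {+ p} {↥ x} p∣↥x
    ... | ℤ∣.divides w ↥x≡w*p = mkM (x * π⁻¹) hz (begin
        x                              ≡⟨ ℚₚ.*-identityʳ x ⟨
        x * 1ℚ                         ≡⟨ cong (x *_) π*π⁻¹ ⟨
        x * (π * π⁻¹)                  ≡⟨ swap x π π⁻¹ ⟩
        π * (x * π⁻¹)                  ≡⟨ cong (λ n → ℕ→ℚ n * (x * π⁻¹)) (ℕₚ.*-identityʳ p) ⟨
        ℕ→ℚ (p ℕ.^ 1) * (x * π⁻¹)      ∎)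
      where
      π⁻¹ = inv (ℕ.pred p)
      π*π⁻¹ : π * π⁻¹ ≡ 1ℚ
      π*π⁻¹ = subst (λ n → ℕ→ℚ n * π⁻¹ ≡ 1ℚ) (ℕₚ.suc-pred p) (*-inv (ℕ.pred p))
      swap : ∀ x q i → x * (q * i) ≡ q * (x * i)
      swap = solve-∀ ℚ-ring
      hz : Zp (x * π⁻¹)
      hz = Zp-fromFraction (↧ₙ x) w hx (begin
        ℕ→ℚ (↧ₙ x) * (x * π⁻¹)   ≡⟨ ℚₚ.*-assoc (ℕ→ℚ (↧ₙ x)) x π⁻¹ ⟨
        ℕ→ℚ (↧ₙ x) * x * π⁻¹     ≡⟨ cong (_* π⁻¹) (↧*≡↥ x) ⟩
        ℤ→ℚ (↥ x) * π⁻¹          ≡⟨ cong (λ z → ℤ→ℚ z * π⁻¹) ↥x≡w*p ⟩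
        ℤ→ℚ (w ℤ.* + p) * π⁻¹    ≡⟨ cong (_* π⁻¹) (ℤ→ℚ-* w (+ p)) ⟩
        ℤ→ℚ w * π * π⁻¹          ≡⟨ ℚₚ.*-assoc (ℤ→ℚ w) π π⁻¹ ⟩
        ℤ→ℚ w * (π * π⁻¹)        ≡⟨ cong (ℤ→ℚ w *_) π*π⁻¹ ⟩
        ℤ→ℚ w * 1ℚ               ≡⟨ ℚₚ.*-identityʳ (ℤ→ℚ w) ⟩
        ℤ→ℚ w                    ∎)

  -- `M 1` is the maximal ideal of the local ring ℤ_p: a p-integral number outside it has a
  -- numerator prime to p, and the absolute value of that numerator is the denominator of `1/ x`.
  -- The zero numerator lies in `M 1`.
  ∉M1⇒Unit : ∀ {x} → Zp x → ¬ M 1 x → Unit x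
  ∉M1⇒Unit {mkℚ (+ zero) d c} hx x∉ = ⊥-elim (x∉ (p∣↥⇒M1 (mkℚ (+ zero) d c) hx (divides 0 refl)))
  ∉M1⇒Unit {x@(mkℚ +[1+ n ] d c)} (zp hx) x∉ =
    mkUnit (ℚ.1/ x) (zp λ p∣n → x∉ (p∣↥⇒M1 x (zp hx) p∣n)) (ℚₚ.*-inverseʳ x)
  ∉M1⇒Unit {x@(mkℚ -[1+ n ] d c)} (zp hx) x∉ =
    mkUnit (ℚ.1/ x) (zp λ p∣n → x∉ (p∣↥⇒M1 x (zp hx) p∣n)) (ℚₚ.*-inverseʳ x)

  -- From 1 = p z the denominator of z equals p times its numerator, which contradicts
  -- p-integrality.
  1∉M1 : ¬ M 1 1ℚ
  1∉M1 (mkM z (zp hz) eq) = hz (subst (p ∣_) (cong ℤ.∣_∣ (sym ↧z≡p*↥z))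
    (subst (p ∣_) (sym (ℤₚ.abs-* (+ p) (↥ z))) (m∣m*n ℤ.∣ ↥ z ∣)))
    where
    swap : ∀ d q z → d * (q * z) ≡ q * (d * z)
    swap = solve-∀ ℚ-ring
    ↧z≡p*↥z : ↧ z ≡ + p ℤ.* ↥ z
    ↧z≡p*↥z = ℤ→ℚ-injective (begin
      ℕ→ℚ (↧ₙ z)                            ≡⟨ ℚₚ.*-identityʳ _ ⟨
      ℕ→ℚ (↧ₙ z) * 1ℚ                       ≡⟨ cong (ℕ→ℚ (↧ₙ z) *_) eq ⟩
      ℕ→ℚ (↧ₙ z) * (ℕ→ℚ (p ℕ.^ 1) * z)      ≡⟨ cong (λ n → ℕ→ℚ (↧ₙ z) * (ℕ→ℚ n * z)) (ℕₚ.*-identityʳ p) ⟩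
      ℕ→ℚ (↧ₙ z) * (π * z)                  ≡⟨ swap (ℕ→ℚ (↧ₙ z)) π z ⟩
      π * (ℕ→ℚ (↧ₙ z) * z)                  ≡⟨ cong (π *_) (↧*≡↥ z) ⟩
      π * ℤ→ℚ (↥ z)                         ≡⟨ ℤ→ℚ-* (+ p) (↥ z) ⟨
      ℤ→ℚ (+ p ℤ.* ↥ z)                     ∎)

  -- Being a unit depends only on the residue modulo p: were x in `M 1`, so would be y and hence 1 =
  -- y i.
  Unit-≡ : ∀ {x y} → Zp y → M 1 (x - y) → Unit y → Unit x
  Unit-≡ {x} {y} hy x≡y (mkUnit i hi yi) = ∉M1⇒Unit hx x∉
    where
    restore : ∀ x y → (x - y) + y ≡ x
    restore = solve-∀ ℚ-ring
    cancel : ∀ x y → x - (x - y) ≡ y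
    cancel = solve-∀ ℚ-ring
    hx : Zp x
    hx = subst (Zp) (restore x y) (Zp-+ (M⇒Zp x≡y) hy)
    x∉ : ¬ M 1 x
    x∉ x∈ = 1∉M1 (M-resp yi (M-*ʳ (M-resp (cancel x y) (M-- x∈ x≡y)) hi))

  Unit-inv : ∀ {k} → suc k < p → Unit (ℕ→ℚ (suc k))
  Unit-inv {k} k<p = mkUnit (inv k) (Zp-inv k<p) (*-inv k)

  -- Lets recurrences be used without division: the claim is multiplied by a leading coefficient,
  -- rewritten by an exact identity as a sum visibly in `M k`, and the coefficient is cancelled
  -- here.
  Unit-cancel : ∀ {k u x} → Unit u → M k (u * x) → M k x
  Unit-cancel {u = u} {x} (mkUnit i hi ui) h = M-resp (begin
      u * x * i      ≡⟨ swap u x i ⟩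
      u * i * x      ≡⟨ cong (_* x) ui ⟩
      1ℚ * x         ≡⟨ ℚₚ.*-identityˡ x ⟩
      x              ∎) (M-*ʳ h hi)
    where
    swap : ∀ u x i → u * x * i ≡ u * i * x
    swap = solve-∀ ℚ-ring

-- Exact identities

-1^ : ℕ → ℚ
-1^ k = (- 1ℚ) ^ℚ k

t : ℚ → ℕ → ℚ
t b k = binom b k * binom b k * -1^ k

T : ℕ → ℚ → ℚ
T n b = Σ< n (t b)

binom-rec : ∀ b k → ℕ→ℚ (suc k) * binom b (suc k) ≡ (b - ℕ→ℚ k) * binom b k
binom-rec b k = begin
  m * (y * (b - n) * i)    ≡⟨ regroup m y (b - n) i ⟩
  m * i * ((b - n) * y)    ≡⟨ cong (_* ((b - n) * y)) (*-inv k) ⟩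
  1ℚ * ((b - n) * y)       ≡⟨ ℚₚ.*-identityˡ ((b - n) * y) ⟩
  (b - n) * y              ∎
  where
  m = ℕ→ℚ (suc k)
  n = ℕ→ℚ k
  i = inv k
  y = binom b k
  regroup : ∀ m y d i → m * (y * d * i) ≡ m * i * (d * y)
  regroup = solve-∀ ℚ-ring

binom-absorb : ∀ a k → binom a (suc k) ≡ a * binom (a - 1ℚ) k * inv k
binom-absorb a zero = base a
  where
  base : ∀ a → 1ℚ * (a - 0ℚ) * 1ℚ ≡ a * 1ℚ * 1ℚ
  base = solve-∀ ℚ-ring
binom-absorb a (suc k) = begin
  binom a (suc k) * (a - ℕ→ℚ (suc k)) * j
    ≡⟨ cong₂ (λ u v → u * (a - v) * j) (binom-absorb a k) (ℕ→ℚ-suc k) ⟩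
  a * binom (a - 1ℚ) k * inv k * (a - (1ℚ + ℕ→ℚ k)) * j
    ≡⟨ regroup a (binom (a - 1ℚ) k) (inv k) (ℕ→ℚ k) j ⟩
  a * (binom (a - 1ℚ) k * (a - 1ℚ - ℕ→ℚ k) * inv k) * j ∎
  where
  j = inv (suc k)
  regroup : ∀ a y i n j → a * y * i * (a - (1ℚ + n)) * j ≡ a * (y * (a - 1ℚ - n) * i) * j
  regroup = solve-∀ ℚ-ring

-- After absorption, a/(k + 1) is split by a = (a - 1 - k) + (k + 1).
pascal : ∀ a k → binom a (suc k) ≡ binom (a - 1ℚ) (suc k) + binom (a - 1ℚ) k
pascal a k = begin
  binom a (suc k)                                 ≡⟨ binom-absorb a k ⟩
  a * y * i                                       ≡⟨ split a y i n ⟩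
  y * (a - 1ℚ - n) * i + (1ℚ + n) * i * y         ≡⟨ cong (λ m → y * (a - 1ℚ - n) * i + m * i * y) (ℕ→ℚ-suc k) ⟨
  y * (a - 1ℚ - n) * i + ℕ→ℚ (suc k) * i * y      ≡⟨ cong (λ m → y * (a - 1ℚ - n) * i + m * y) (*-inv k) ⟩
  y * (a - 1ℚ - n) * i + 1ℚ * y                   ≡⟨ cong (λ m → y * (a - 1ℚ - n) * i + m) (ℚₚ.*-identityˡ y) ⟩
  binom (a - 1ℚ) (suc k) + binom (a - 1ℚ) k       ∎
  where
  n = ℕ→ℚ k
  i = inv k
  y = binom (a - 1ℚ) k
  split : ∀ a y i n → a * y * i ≡ y * (a - 1ℚ - n) * i + (1ℚ + n) * i * y
  split = solve-∀ ℚ-ring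

pascal₁ : ∀ b k → binom (b + 1ℚ) (suc k) ≡ binom b (suc k) + binom b k
pascal₁ b k = subst (λ c → binom (b + 1ℚ) (suc k) ≡ binom c (suc k) + binom c k) (cancel b) (pascal (b + 1ℚ) k)
  where
  cancel : ∀ b → b + 1ℚ - 1ℚ ≡ b
  cancel = solve-∀ ℚ-ring

-- The sign (-1)^k turns the difference C(a-1,k)² - C(a-1,k-1)² into two added copies of T, the
-- shifted one lacking its last term. Here w is 2/a, specified by w a = 2 so that no division
-- enters.
weightedSum : ∀ a w n → w * a ≡ ℕ→ℚ 2 →
  Σ< (suc n) (λ k → binom a k * binom a k * -1^ k * (1ℚ - w * ℕ→ℚ k))
    ≡ ℕ→ℚ 2 * T (suc n) (a - 1ℚ) - t (a - 1ℚ) n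
weightedSum a w zero wa = base w
  where
  base : ∀ w → 0ℚ + 1ℚ * 1ℚ * 1ℚ * (1ℚ - w * 0ℚ) ≡ ℕ→ℚ 2 * (0ℚ + 1ℚ * 1ℚ * 1ℚ) - 1ℚ * 1ℚ * 1ℚ
  base = solve-∀ ℚ-ring
weightedSum a w (suc n) wa = begin
  S + X * X * (- 1ℚ * s) * (1ℚ - w * m)
    ≡⟨ cong (λ u → u + X * X * (- 1ℚ * s) * (1ℚ - w * m)) (weightedSum a w n wa) ⟩
  ℕ→ℚ 2 * τ - y * y * s + X * X * (- 1ℚ * s) * (1ℚ - w * m)
    ≡⟨ expand τ y s X w m ⟩
  ℕ→ℚ 2 * τ - y * y * s - s * X * (X - X * (w * m))
    ≡⟨ cong₂ (λ u v → ℕ→ℚ 2 * τ - y * y * s - s * u * (u - v)) (pascal a n) Xwm ⟩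
  ℕ→ℚ 2 * τ - y * y * s - s * (z + y) * (z + y - ℕ→ℚ 2 * y)
    ≡⟨ collect τ y s z ⟩
  ℕ→ℚ 2 * (τ + z * z * (- 1ℚ * s)) - z * z * (- 1ℚ * s) ∎
  where
  S = Σ< (suc n) (λ k → binom a k * binom a k * -1^ k * (1ℚ - w * ℕ→ℚ k))
  X = binom a (suc n)
  y = binom (a - 1ℚ) n
  z = binom (a - 1ℚ) (suc n)
  s = -1^ n
  m = ℕ→ℚ (suc n)
  i = inv n
  τ = T (suc n) (a - 1ℚ)
  expand : ∀ τ y s X w m → ℕ→ℚ 2 * τ - y * y * s + X * X * (- 1ℚ * s) * (1ℚ - w * m)
    ≡ ℕ→ℚ 2 * τ - y * y * s - s * X * (X - X * (w * m))
  expand = solve-∀ ℚ-ring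
  collect : ∀ τ y s z → ℕ→ℚ 2 * τ - y * y * s - s * (z + y) * (z + y - ℕ→ℚ 2 * y)
    ≡ ℕ→ℚ 2 * (τ + z * z * (- 1ℚ * s)) - z * z * (- 1ℚ * s)
  collect = solve-∀ ℚ-ring
  regroup : ∀ a y i w m → a * y * i * (w * m) ≡ w * a * (m * i) * y
  regroup = solve-∀ ℚ-ring
  Xwm : X * (w * m) ≡ ℕ→ℚ 2 * y
  Xwm = begin
    X * (w * m)                ≡⟨ cong (_* (w * m)) (binom-absorb a n) ⟩
    a * y * i * (w * m)        ≡⟨ regroup a y i w m ⟩
    w * a * (m * i) * y        ≡⟨ cong₂ (λ u v → u * v * y) wa (*-inv n) ⟩
    ℕ→ℚ 2 * 1ℚ * y             ≡⟨⟩
    ℕ→ℚ 2 * y                  ∎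

-- Found by creative telescoping: (b+2) t(b+2,k) + 4(b+1) t(b,k) is the forward difference
-- in k of ± boundary b (C(b,k−1)) (C(b,k−2)).
boundary : ℚ → ℚ → ℚ → ℚ
boundary b x y =
  (ℕ→ℚ 6 + ℕ→ℚ 5 * b) * (x * x) + (ℕ→ℚ 6 + ℕ→ℚ 4 * b) * (x * y) + (ℕ→ℚ 2 + b) * (y * y)

-- Here x, y, z stand for C(b,k+1), C(b,k), C(b,k+2), and z + x + (x + y) is C(b+2,k+2) by Pascal's
-- rule applied twice. The two sides differ by a combination of the contiguity relations `hx` and
-- `hz`, with multipliers -2(x + z) and 2(x + y).
certificate : ∀ b k x y z → (1ℚ + k) * x ≡ (b - k) * y → (ℕ→ℚ 2 + k) * z ≡ (b - (1ℚ + k)) * x →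
  (b + ℕ→ℚ 2) * ((z + x + (x + y)) * (z + x + (x + y))) + ℕ→ℚ 4 * (b + 1ℚ) * (z * z)
    ≡ boundary b z x + boundary b x y
certificate b k x y z hx hz = begin
  (b + ℕ→ℚ 2) * ((z + x + (x + y)) * (z + x + (x + y))) + ℕ→ℚ 4 * (b + 1ℚ) * (z * z)
    ≡⟨ identity b k x y z ⟩
  boundary b z x + boundary b x y
    + ((1ℚ + k) * x - (b - k) * y) * (- ℕ→ℚ 2 * (x + z))
    + ((ℕ→ℚ 2 + k) * z - (b - (1ℚ + k)) * x) * (ℕ→ℚ 2 * (x + y))
    ≡⟨ cong₂ (λ u v → boundary b z x + boundary b x y
         + (u - (b - k) * y) * (- ℕ→ℚ 2 * (x + z)) + (v - (b - (1ℚ + k)) * x) * (ℕ→ℚ 2 * (x + y))) hx hz ⟩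
  boundary b z x + boundary b x y
    + ((b - k) * y - (b - k) * y) * (- ℕ→ℚ 2 * (x + z))
    + ((b - (1ℚ + k)) * x - (b - (1ℚ + k)) * x) * (ℕ→ℚ 2 * (x + y))
    ≡⟨ vanish (boundary b z x + boundary b x y) ((b - k) * y) ((b - (1ℚ + k)) * x) (- ℕ→ℚ 2 * (x + z)) (ℕ→ℚ 2 * (x + y)) ⟩
  boundary b z x + boundary b x y ∎
  where
  identity : ∀ b k x y z →
    (b + ℕ→ℚ 2) * ((z + x + (x + y)) * (z + x + (x + y))) + ℕ→ℚ 4 * (b + 1ℚ) * (z * z)
    ≡ ((ℕ→ℚ 6 + ℕ→ℚ 5 * b) * (z * z) + (ℕ→ℚ 6 + ℕ→ℚ 4 * b) * (z * x) + (ℕ→ℚ 2 + b) * (x * x))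
      + ((ℕ→ℚ 6 + ℕ→ℚ 5 * b) * (x * x) + (ℕ→ℚ 6 + ℕ→ℚ 4 * b) * (x * y) + (ℕ→ℚ 2 + b) * (y * y))
      + ((1ℚ + k) * x - (b - k) * y) * (- ℕ→ℚ 2 * (x + z))
      + ((ℕ→ℚ 2 + k) * z - (b - (1ℚ + k)) * x) * (ℕ→ℚ 2 * (x + y))
  identity = solve-∀ ℚ-ring
  vanish : ∀ g u v m n → g + (u - u) * m + (v - v) * n ≡ g
  vanish = solve-∀ ℚ-ring

-- Exact over ℚ for every truncation: summing the forward difference leaves only its value at the
-- upper end. Divisibility enters later, through the two binomials in that value.
T-recurrence : ∀ n b →
  (b + ℕ→ℚ 2) * T (suc (suc n)) (b + 1ℚ + 1ℚ) + ℕ→ℚ 4 * (b + 1ℚ) * T (suc (suc n)) b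
    ≡ -1^ (suc n) * boundary b (binom b (suc n)) (binom b n)
T-recurrence zero b = base b
  where
  base : ∀ b →
    (b + ℕ→ℚ 2) * (0ℚ + 1ℚ * 1ℚ * 1ℚ + (1ℚ * (b + 1ℚ + 1ℚ - 0ℚ) * 1ℚ) * (1ℚ * (b + 1ℚ + 1ℚ - 0ℚ) * 1ℚ) * (- 1ℚ * 1ℚ))
      + ℕ→ℚ 4 * (b + 1ℚ) * (0ℚ + 1ℚ * 1ℚ * 1ℚ + (1ℚ * (b - 0ℚ) * 1ℚ) * (1ℚ * (b - 0ℚ) * 1ℚ) * (- 1ℚ * 1ℚ))
    ≡ - 1ℚ * 1ℚ * ((ℕ→ℚ 6 + ℕ→ℚ 5 * b) * ((1ℚ * (b - 0ℚ) * 1ℚ) * (1ℚ * (b - 0ℚ) * 1ℚ))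
      + (ℕ→ℚ 6 + ℕ→ℚ 4 * b) * ((1ℚ * (b - 0ℚ) * 1ℚ) * 1ℚ) + (ℕ→ℚ 2 + b) * (1ℚ * 1ℚ))
  base = solve-∀ ℚ-ring
T-recurrence (suc n) b = begin
  (b + ℕ→ℚ 2) * (τ' + X * X * (- 1ℚ * s)) + ℕ→ℚ 4 * (b + 1ℚ) * (τ + z * z * (- 1ℚ * s))
    ≡⟨ split b τ' X s τ z ⟩
  (b + ℕ→ℚ 2) * τ' + ℕ→ℚ 4 * (b + 1ℚ) * τ - s * ((b + ℕ→ℚ 2) * (X * X) + ℕ→ℚ 4 * (b + 1ℚ) * (z * z))
    ≡⟨ cong₂ (λ u v → u - s * v) (T-recurrence n b) D ⟩
  s * boundary b x y - s * (boundary b z x + boundary b x y)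
    ≡⟨ collect s (boundary b x y) (boundary b z x) ⟩
  - 1ℚ * s * boundary b z x ∎
  where
  τ = T (suc (suc n)) b
  τ' = T (suc (suc n)) (b + 1ℚ + 1ℚ)
  s = -1^ (suc n)
  X = binom (b + 1ℚ + 1ℚ) (suc (suc n))
  x = binom b (suc n)
  y = binom b n
  z = binom b (suc (suc n))
  k = ℕ→ℚ n
  split : ∀ b τ' X s τ z →
    (b + ℕ→ℚ 2) * (τ' + X * X * (- 1ℚ * s)) + ℕ→ℚ 4 * (b + 1ℚ) * (τ + z * z * (- 1ℚ * s))
    ≡ (b + ℕ→ℚ 2) * τ' + ℕ→ℚ 4 * (b + 1ℚ) * τ - s * ((b + ℕ→ℚ 2) * (X * X) + ℕ→ℚ 4 * (b + 1ℚ) * (z * z))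
  split = solve-∀ ℚ-ring
  collect : ∀ s g h → s * g - s * (h + g) ≡ - 1ℚ * s * h
  collect = solve-∀ ℚ-ring
  X≡ : X ≡ z + x + (x + y)
  X≡ = trans (pascal₁ (b + 1ℚ) (suc n)) (cong₂ _+_ (pascal₁ b (suc n)) (pascal₁ b n))
  D : (b + ℕ→ℚ 2) * (X * X) + ℕ→ℚ 4 * (b + 1ℚ) * (z * z) ≡ boundary b z x + boundary b x y
  D = trans (cong (λ u → (b + ℕ→ℚ 2) * (u * u) + ℕ→ℚ 4 * (b + 1ℚ) * (z * z)) X≡)
    (certificate b k x y z
      (trans (cong (_* x) (sym (ℕ→ℚ-suc n))) (binom-rec b n))
      (trans (cong (_* z) (sym (ℕ→ℚ-+ 2 n)))
        (trans (binom-rec b (suc n)) (cong (λ m → (b - m) * x) (ℕ→ℚ-suc n)))))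

-- Recursive rather than 2 * n, so that sums and harmonic numbers at even indices unfold two terms
-- per step.
double : ℕ → ℕ
double zero    = zero
double (suc n) = suc (suc (double n))

double≡2* : ∀ n → double n ≡ 2 ℕ.* n
double≡2* zero    = refl
double≡2* (suc n) = cong suc (trans (cong suc (double≡2* n)) (sym (ℕₚ.+-suc n (n ℕ.+ 0))))

double≡+ : ∀ n → double n ≡ n ℕ.+ n
double≡+ n = trans (double≡2* n) (cong (n ℕ.+_) (ℕₚ.+-identityʳ n))

n≤double : ∀ n → n ≤ double n
n≤double n = subst (n ≤_) (sym (double≡+ n)) (ℕₚ.m≤m+n n n)

double-+ : ∀ m n → double (m ℕ.+ n) ≡ double m ℕ.+ double n
double-+ zero    n = refl
double-+ (suc m) n = cong (λ k → suc (suc k)) (double-+ m n)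

double/2 : ∀ n → double n / 2 ≡ n
double/2 n = trans (cong (_/ 2) (trans (double≡2* n) (ℕₚ.*-comm 2 n))) (m*n/n≡m n 2)

ℕ→ℚ-double : ∀ n → ℕ→ℚ (double n) ≡ ℕ→ℚ 2 * ℕ→ℚ n
ℕ→ℚ-double n = trans (cong ℕ→ℚ (double≡2* n)) (ℕ→ℚ-* 2 n)

ℕ→ℚ-2+ : ∀ n → ℕ→ℚ (suc (suc n)) ≡ ℕ→ℚ 2 + ℕ→ℚ n
ℕ→ℚ-2+ = ℕ→ℚ-+ 2

inverse-unique : ∀ {x y z} → x * y ≡ 1ℚ → x * z ≡ 1ℚ → y ≡ z
inverse-unique {x} {y} {z} xy xz = begin
  y            ≡⟨ ℚₚ.*-identityˡ y ⟨
  1ℚ * y       ≡⟨ cong (_* y) xz ⟨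
  x * z * y    ≡⟨ swap x z y ⟩
  x * y * z    ≡⟨ cong (_* z) xy ⟩
  1ℚ * z       ≡⟨ ℚₚ.*-identityˡ z ⟩
  z            ∎
  where
  swap : ∀ x z y → x * z * y ≡ x * y * z
  swap = solve-∀ ℚ-ring

inv-double : ∀ n → inv n ≡ ℕ→ℚ 2 * inv (suc (double n))
inv-double n = inverse-unique {ℕ→ℚ (suc n)} (*-inv n) (begin
  ℕ→ℚ (suc n) * (ℕ→ℚ 2 * e)    ≡⟨ regroup (ℕ→ℚ (suc n)) e ⟩
  ℕ→ℚ 2 * ℕ→ℚ (suc n) * e      ≡⟨ cong (_* e) (ℕ→ℚ-double (suc n)) ⟨
  ℕ→ℚ (double (suc n)) * e     ≡⟨ *-inv (suc (double n)) ⟩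
  1ℚ                           ∎)
  where
  e = inv (suc (double n))
  regroup : ∀ x e → x * (ℕ→ℚ 2 * e) ≡ ℕ→ℚ 2 * x * e
  regroup = solve-∀ ℚ-ring

-1^-square : ∀ k → -1^ k * -1^ k ≡ 1ℚ
-1^-square zero    = refl
-1^-square (suc k) = trans (regroup (-1^ k)) (-1^-square k)
  where
  regroup : ∀ s → (- 1ℚ * s) * (- 1ℚ * s) ≡ s * s
  regroup = solve-∀ ℚ-ring

-1^-double : ∀ k → -1^ (double k) ≡ 1ℚ
-1^-double zero    = refl
-1^-double (suc k) = trans (regroup (-1^ (double k))) (-1^-double k)
  where
  regroup : ∀ s → - 1ℚ * (- 1ℚ * s) ≡ s
  regroup = solve-∀ ℚ-ring

-- Binomial coefficients at natural arguments

binom-0ℚ : ∀ k → binom 0ℚ (suc k) ≡ 0ℚ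
binom-0ℚ k = trans (binom-absorb 0ℚ k) (vanish (binom (0ℚ - 1ℚ) k) (inv k))
  where
  vanish : ∀ y i → 0ℚ * y * i ≡ 0ℚ
  vanish = solve-∀ ℚ-ring

ℕ→ℚ-suc-1 : ∀ n → ℕ→ℚ (suc n) - 1ℚ ≡ ℕ→ℚ n
ℕ→ℚ-suc-1 n = trans (cong (_- 1ℚ) (ℕ→ℚ-suc n)) (cancel (ℕ→ℚ n))
  where
  cancel : ∀ x → 1ℚ + x - 1ℚ ≡ x
  cancel = solve-∀ ℚ-ring

pascal-ℕ : ∀ n k → binom (ℕ→ℚ (suc n)) (suc k) ≡ binom (ℕ→ℚ n) (suc k) + binom (ℕ→ℚ n) k
pascal-ℕ n k = subst (λ c → binom (ℕ→ℚ (suc n)) (suc k) ≡ binom c (suc k) + binom c k)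
  (ℕ→ℚ-suc-1 n) (pascal (ℕ→ℚ (suc n)) k)

binom-ℕ : ∀ n k → binom (ℕ→ℚ n) k ≡ ℕ→ℚ (n C k)
binom-ℕ zero    zero    = refl
binom-ℕ (suc n) zero    = refl
binom-ℕ zero    (suc k) = binom-0ℚ k
binom-ℕ (suc n) (suc k) = begin
  binom (ℕ→ℚ (suc n)) (suc k)                  ≡⟨ pascal-ℕ n k ⟩
  binom (ℕ→ℚ n) (suc k) + binom (ℕ→ℚ n) k      ≡⟨ cong₂ _+_ (binom-ℕ n (suc k)) (binom-ℕ n k) ⟩
  ℕ→ℚ (n C suc k) + ℕ→ℚ (n C k)                ≡⟨ ℚₚ.+-comm (ℕ→ℚ (n C suc k)) (ℕ→ℚ (n C k)) ⟩
  ℕ→ℚ (n C k) + ℕ→ℚ (n C suc k)                ≡⟨ ℕ→ℚ-+ (n C k) (n C suc k) ⟨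
  ℕ→ℚ (n C k ℕ.+ n C suc k)                    ≡⟨ cong ℕ→ℚ (nCk+nC[k+1]≡[n+1]C[k+1] n k) ⟩
  ℕ→ℚ (suc n C suc k)                          ∎

binom-overflow : ∀ n → binom (ℕ→ℚ n) (suc n) ≡ 0ℚ
binom-overflow n = trans (binom-ℕ n (suc n)) (cong ℕ→ℚ (k>n⇒nCk≡0 (ℕₚ.n<1+n n)))

Σ-pascal : ∀ n m → Σ< (suc m) (binom (ℕ→ℚ (suc n))) ≡ Σ< (suc m) (binom (ℕ→ℚ n)) + Σ< m (binom (ℕ→ℚ n))
Σ-pascal n zero    = refl
Σ-pascal n (suc m) = begin
  Σ< (suc m) (binom (ℕ→ℚ (suc n))) + binom (ℕ→ℚ (suc n)) (suc m)
    ≡⟨ cong₂ _+_ (Σ-pascal n m) (pascal-ℕ n m) ⟩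
  A + B + (z + y)        ≡⟨ regroup A B z y ⟩
  A + z + (B + y)        ∎
  where
  A = Σ< (suc m) (binom (ℕ→ℚ n))
  B = Σ< m (binom (ℕ→ℚ n))
  z = binom (ℕ→ℚ n) (suc m)
  y = binom (ℕ→ℚ n) m
  regroup : ∀ A B z y → A + B + (z + y) ≡ A + z + (B + y)
  regroup = solve-∀ ℚ-ring

Σ-binom : ∀ n → Σ< (suc n) (binom (ℕ→ℚ n)) ≡ ℕ→ℚ (2 ℕ.^ n)
Σ-binom zero    = refl
Σ-binom (suc n) = begin
  Σ< (suc (suc n)) (binom (ℕ→ℚ (suc n)))     ≡⟨ Σ-pascal n (suc n) ⟩
  A + binom (ℕ→ℚ n) (suc n) + A              ≡⟨ cong (λ z → A + z + A) (binom-overflow n) ⟩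
  A + 0ℚ + A                                 ≡⟨ twice A ⟩
  ℕ→ℚ 2 * A                                  ≡⟨ cong (ℕ→ℚ 2 *_) (Σ-binom n) ⟩
  ℕ→ℚ 2 * ℕ→ℚ (2 ℕ.^ n)                      ≡⟨ ℕ→ℚ-* 2 (2 ℕ.^ n) ⟨
  ℕ→ℚ (2 ℕ.^ suc n)                          ∎
  where
  A = Σ< (suc n) (binom (ℕ→ℚ n))
  twice : ∀ A → A + 0ℚ + A ≡ ℕ→ℚ 2 * A
  twice = solve-∀ ℚ-ring

central : ℕ → ℚ
central j = binom (ℕ→ℚ (double j)) j

central-suc : ∀ j → central (suc j) ≡ central j * (ℕ→ℚ 2 * ℕ→ℚ (suc (double j))) * inv j
central-suc j = begin
  binom N₂ (suc j)                       ≡⟨ binom-absorb N₂ j ⟩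
  N₂ * binom (N₂ - 1ℚ) j * i             ≡⟨ cong₂ (λ u v → u * binom v j * i) (ℕ→ℚ-double (suc j)) (ℕ→ℚ-suc-1 (suc (double j))) ⟩
  ℕ→ℚ 2 * m * binom N₁ j * i             ≡⟨ cong (_* i) (ℚₚ.*-assoc (ℕ→ℚ 2) m (binom N₁ j)) ⟩
  -- The symmetry C(2j+1, j) = C(2j+1, j+1), obtained from the ratio of consecutive binomials
  -- because 2j + 1 - j = j + 1.
  ℕ→ℚ 2 * (m * binom N₁ j) * i           ≡⟨ cong (λ u → ℕ→ℚ 2 * u * i) flip ⟨
  ℕ→ℚ 2 * (m * binom N₁ (suc j)) * i     ≡⟨ cong (λ u → ℕ→ℚ 2 * (m * u) * i) N₁Cj+1 ⟩
  ℕ→ℚ 2 * (m * (N₁ * c * i)) * i         ≡⟨ regroup m N₁ c i ⟩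
  c * (ℕ→ℚ 2 * N₁) * i * (m * i)         ≡⟨ cong (c * (ℕ→ℚ 2 * N₁) * i *_) (*-inv j) ⟩
  c * (ℕ→ℚ 2 * N₁) * i * 1ℚ              ≡⟨ ℚₚ.*-identityʳ (c * (ℕ→ℚ 2 * N₁) * i) ⟩
  c * (ℕ→ℚ 2 * N₁) * i                   ∎
  where
  N₂ = ℕ→ℚ (double (suc j))
  N₁ = ℕ→ℚ (suc (double j))
  m = ℕ→ℚ (suc j)
  i = inv j
  c = central j
  N₁Cj+1 : binom N₁ (suc j) ≡ N₁ * c * i
  N₁Cj+1 = trans (binom-absorb N₁ j) (cong (λ u → N₁ * binom u j * i) (ℕ→ℚ-suc-1 (double j)))
  N₁-j : N₁ - ℕ→ℚ j ≡ m
  N₁-j = begin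
    N₁ - ℕ→ℚ j                          ≡⟨ cong (_- ℕ→ℚ j) (trans (ℕ→ℚ-suc (double j)) (cong (λ u → 1ℚ + u) (ℕ→ℚ-double j))) ⟩
    1ℚ + ℕ→ℚ 2 * ℕ→ℚ j - ℕ→ℚ j          ≡⟨ halve (ℕ→ℚ j) ⟩
    1ℚ + ℕ→ℚ j                          ≡⟨ ℕ→ℚ-suc j ⟨
    m                                   ∎
    where
    halve : ∀ x → 1ℚ + ℕ→ℚ 2 * x - x ≡ 1ℚ + x
    halve = solve-∀ ℚ-ring
  flip : m * binom N₁ (suc j) ≡ m * binom N₁ j
  flip = trans (binom-rec N₁ j) (cong (_* binom N₁ j) N₁-j)
  regroup : ∀ m n c i → ℕ→ℚ 2 * (m * (n * c * i)) * i ≡ c * (ℕ→ℚ 2 * n) * i * (m * i)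
  regroup = solve-∀ ℚ-ring

-- Equal to 16^j, but written so that at r = 2j it is literally the 2^(2r) of the claim.
16^ : ℕ → ℚ
16^ j = ℕ→ℚ (2 ℕ.^ (2 ℕ.* double j))

16^-suc : ∀ j → 16^ (suc j) ≡ ℕ→ℚ 16 * 16^ j
16^-suc j = trans
  (cong (λ k → ℕ→ℚ (2 ℕ.^ k)) (trans (ℕₚ.*-distribˡ-+ 2 2 (double j)) refl))
  (trans (cong ℕ→ℚ (ℕₚ.^-distribˡ-+-* 2 4 (2 ℕ.* double j))) (ℕ→ℚ-* 16 (2 ℕ.^ (2 ℕ.* double j))))

-- Divisibility of binomial coefficients and the recurrence modulo p²

module Congruences (p : ℕ) (p-prime : Prime p) where

  open Localisation p p-prime

  record Residue (b : ℚ) (n : ℕ) : Set where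
    constructor residue
    field
      difference : M 1 (b - ℕ→ℚ n)

  Zp-near : ∀ {b n} → Residue b n → Zp b
  Zp-near {b} {n} (residue b≡n) = subst Zp (restore b (ℕ→ℚ n)) (Zp-+ (M⇒Zp b≡n) (Zp-ℕ n))
    where
    restore : ∀ x y → x - y + y ≡ x
    restore = solve-∀ ℚ-ring

  Unit-near : ∀ {b n} → suc n < p → Residue b (suc n) → Unit b
  Unit-near {n = n} n<p (residue b≡n) = Unit-≡ (Zp-ℕ (suc n)) b≡n (Unit-inv n<p)

  Zp--1^ : ∀ k → Zp (-1^ k)
  Zp--1^ zero    = Zp-ℤ (+ 1)
  Zp--1^ (suc k) = Zp-* (Zp-ℤ -[1+ 0 ]) (Zp--1^ k)

  Zp-binom : ∀ {b} k → Zp b → k < p → Zp (binom b k)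
  Zp-binom zero    hb k<p = Zp-ℤ (+ 1)
  Zp-binom (suc k) hb k<p =
    Zp-* (Zp-* (Zp-binom k hb (ℕₚ.<⇒≤ k<p)) (Zp-- hb (Zp-ℕ k))) (Zp-inv k<p)

  Zp-H : ∀ k → k < p → Zp (H k)
  Zp-H zero    k<p = Zp-ℤ (+ 0)
  Zp-H (suc k) k<p = Zp-+ (Zp-H k (ℕₚ.<⇒≤ k<p)) (Zp-inv k<p)

  -- Once k exceeds n, the factor b - n occurs in the numerator of C(b,k), while the denominators up
  -- to k < p are prime to p.
  binom∈M1 : ∀ {b n} k → Residue b n → n < k → k < p → M 1 (binom b k)
  binom∈M1 {b} {n} (suc k) r@(residue b≡n) n<k k<p with ℕₚ.m≤n⇒m<n∨m≡n n<k
  ... | inj₁ (s≤s n<k′) =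
    M-*ʳ (M-*ʳ (binom∈M1 k r n<k′ (ℕₚ.<⇒≤ k<p)) (Zp-- (Zp-near r) (Zp-ℕ k))) (Zp-inv k<p)
  ... | inj₂ refl =
    M-*ʳ (M-*ˡ (Zp-binom k (Zp-near r) (ℕₚ.<⇒≤ k<p)) b≡n) (Zp-inv k<p)

  t∈M2 : ∀ {b n} k → Residue b n → n < k → k < p → M 2 (t b k)
  t∈M2 k b≡n n<k k<p = M-*ʳ (M-1* K∈ K∈) (Zp--1^ k)
    where K∈ = binom∈M1 k b≡n n<k k<p

  boundary∈M2 : ∀ {b x y} → Zp b → M 1 x → M 1 y → M 2 (boundary b x y)
  boundary∈M2 hb hx hy = M-+ (M-+
    (M-*ˡ (Zp-+ (Zp-ℕ 6) (Zp-* (Zp-ℕ 5) hb)) (M-1* hx hx))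
    (M-*ˡ (Zp-+ (Zp-ℕ 6) (Zp-* (Zp-ℕ 4) hb)) (M-1* hx hy)))
    (M-*ˡ (Zp-+ (Zp-ℕ 2) hb) (M-1* hy hy))

  -- The bound says n < p - 2, so C(b,p-1) and C(b,p-2) are both divisible by p, and every monomial
  -- of `boundary` has degree two in them.
  T-step : ∀ {b n} → Residue b n → suc (suc (suc n)) ≤ p →
    M 2 ((b + ℕ→ℚ 2) * T p (b + 1ℚ + 1ℚ) + ℕ→ℚ 4 * (b + 1ℚ) * T p b)
  T-step {b} {n} b≡n n+3≤p = subst
    (λ q → M 2 ((b + ℕ→ℚ 2) * T q (b + 1ℚ + 1ℚ) + ℕ→ℚ 4 * (b + 1ℚ) * T q b))
    2+m≡p
    (M-resp (sym (T-recurrence m b)) (M-*ˡ (Zp--1^ (suc m)) (boundary∈M2 (Zp-near b≡n)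
      (binom∈M1 (suc m) b≡n (ℕₚ.m≤n⇒m≤1+n n<m) m+1<p)
      (binom∈M1 m b≡n n<m (ℕₚ.<⇒≤ m+1<p)))))
    where
    m = p ∸ 2
    2+m≡p : suc (suc m) ≡ p
    2+m≡p = ℕₚ.m+[n∸m]≡n {2} (ℕₚ.≤-trans (s≤s (s≤s z≤n)) n+3≤p)
    m+1<p : suc m < p
    m+1<p = ℕₚ.≤-reflexive 2+m≡p
    n<m : n < m
    n<m = ℕₚ.∸-monoˡ-≤ 2 n+3≤p

  -- Even residues

  -- The terms k = 0, 1 give 1 - (c + 1)² = -2c - c²; each later term is the square of a multiple of
  -- p.
  T-start : ∀ {c} m → M 1 c → suc m < p → M 2 (T (suc (suc m)) (c + ℕ→ℚ 1) - (- ℕ→ℚ 2) * c)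
  T-start {c} zero hc m<p = M-resp (sym (identity c)) (M-neg (M-1* hc hc))
    where
    identity : ∀ c → 0ℚ + 1ℚ * 1ℚ * 1ℚ + (1ℚ * (c + 1ℚ - 0ℚ) * 1ℚ) * (1ℚ * (c + 1ℚ - 0ℚ) * 1ℚ) * (- 1ℚ * 1ℚ)
      - (- ℕ→ℚ 2) * c ≡ - (c * c)
    identity = solve-∀ ℚ-ring
  T-start {c} (suc m) hc m<p = M-resp (regroup (T (suc (suc m)) b) (t b (suc (suc m))) (- ℕ→ℚ 2 * c))
    (M-+ (T-start m hc (ℕₚ.<⇒≤ m<p)) (t∈M2 (suc (suc m)) (residue (M-resp (cancel c) hc)) (s≤s (s≤s z≤n)) m<p))
    where
    b = c + ℕ→ℚ 1
    cancel : ∀ c → c ≡ c + ℕ→ℚ 1 - ℕ→ℚ 1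
    cancel = solve-∀ ℚ-ring
    regroup : ∀ x y z → x - z + y ≡ x + y - z
    regroup = solve-∀ ℚ-ring

  -- The coefficient of c in T(c + 2j + 1). The recurrence multiplies T by -4(c + v)/(c + v + 1)
  -- with v = 2(j + 1); as T is already divisible by p, the factor may be evaluated at c = 0.
  weight : ℕ → ℚ
  weight zero    = - ℕ→ℚ 2
  weight (suc j) = weight j * (- ℕ→ℚ 4 * ℕ→ℚ (double (suc j))) * inv (double (suc j))

  Zp-weight : ∀ j → suc (double j) < p → Zp (weight j)
  Zp-weight zero    _ = Zp-neg (Zp-ℕ 2)
  Zp-weight (suc j) h = Zp-* (Zp-* (Zp-weight j (ℕₚ.<⇒≤ (ℕₚ.<⇒≤ h)))
    (Zp-* (Zp-neg (Zp-ℕ 4)) (Zp-ℕ (double (suc j))))) (Zp-inv h)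

  T-even : ∀ {c} j → M 1 c → suc (double j) < p → M 2 (T p (c + ℕ→ℚ (suc (double j))) - weight j * c)
  T-even {c} zero hc 1<p = subst (λ q → M 2 (T q (c + ℕ→ℚ 1) - - ℕ→ℚ 2 * c)) 2+m≡p
    (T-start (p ∸ 2) hc (ℕₚ.≤-reflexive 2+m≡p))
    where
    2+m≡p : suc (suc (p ∸ 2)) ≡ p
    2+m≡p = ℕₚ.m+[n∸m]≡n {2} 1<p
  T-even {c} (suc j) hc h = Unit-cancel (Unit-near {c + (1ℚ + v)} h (residue (M-resp c≡ hc)))
    (M-resp (sym identity)
      (M-+ (M-- step (M-*ˡ (Zp-* (Zp-ℕ 4) (Zp-+ (M⇒Zp hc) (Zp-ℕ (double (suc j))))) (T-even j hc (ℕₚ.<⇒≤ (ℕₚ.<⇒≤ h)))))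
        (M-*ʳ (M-1* hc hc) (Zp-* (Zp-* (Zp-ℕ 4) (Zp-weight j (ℕₚ.<⇒≤ (ℕₚ.<⇒≤ h))))
          (Zp-- (Zp-* (Zp-ℕ (double (suc j))) (Zp-inv h)) (Zp-ℤ (+ 1)))))))
    where
    v = ℕ→ℚ (double (suc j))
    i = inv (double (suc j))
    w = weight j
    τ = T p (c + ℕ→ℚ (suc (double j)))
    τ' = T p (c + ℕ→ℚ (suc (double (suc j))))
    v+1 : ℕ→ℚ (suc (double (suc j))) ≡ 1ℚ + v
    v+1 = ℕ→ℚ-suc (double (suc j))
    v-1 : ℕ→ℚ (suc (double j)) ≡ v - 1ℚ
    v-1 = sym (ℕ→ℚ-suc-1 (suc (double j)))
    c≡ : c ≡ c + (1ℚ + v) - ℕ→ℚ (suc (double (suc j)))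
    c≡ = trans (cancel c (1ℚ + v)) (cong (λ u → c + (1ℚ + v) - u) (sym v+1))
      where
      cancel : ∀ c v → c ≡ c + v - v
      cancel = solve-∀ ℚ-ring
    step : M 2 ((c + (1ℚ + v)) * τ' + ℕ→ℚ 4 * (c + v) * τ)
    step = M-resp
      (cong₂ _+_
        (cong₂ _*_ (trans (cong (λ u → c + u + ℕ→ℚ 2) v-1) (plus2 c v))
                   (cong (T p) (trans (cong (λ u → c + u + 1ℚ + 1ℚ) v-1) (trans (plus11 c v) (cong (λ u → c + u) (sym v+1))))))
        (cong (λ u → ℕ→ℚ 4 * u * τ) (trans (cong (λ u → c + u + 1ℚ) v-1) (plus1 c v))))
      (T-step {c + ℕ→ℚ (suc (double j))} {suc (double j)} (residue (M-resp (cancel c (ℕ→ℚ (suc (double j)))) hc)) h)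
      where
      cancel : ∀ c v → c ≡ c + v - v
      cancel = solve-∀ ℚ-ring
      plus2 : ∀ c v → c + (v - 1ℚ) + ℕ→ℚ 2 ≡ c + (1ℚ + v)
      plus2 = solve-∀ ℚ-ring
      plus11 : ∀ c v → c + (v - 1ℚ) + 1ℚ + 1ℚ ≡ c + (1ℚ + v)
      plus11 = solve-∀ ℚ-ring
      plus1 : ∀ c v → c + (v - 1ℚ) + 1ℚ ≡ c + v
      plus1 = solve-∀ ℚ-ring
    -- The c² term is the error made in `weight` by evaluating the step factor at c = 0.
    identity : (c + (1ℚ + v)) * (τ' - w * (- ℕ→ℚ 4 * v) * i * c)
      ≡ (c + (1ℚ + v)) * τ' + ℕ→ℚ 4 * (c + v) * τ - ℕ→ℚ 4 * (c + v) * (τ - w * c)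
        + c * c * (ℕ→ℚ 4 * w * (v * i - 1ℚ))
    identity = begin
      (c + (1ℚ + v)) * (τ' - w * (- ℕ→ℚ 4 * v) * i * c)
        ≡⟨ expand c v τ' τ w i ⟩
      (c + (1ℚ + v)) * τ' + ℕ→ℚ 4 * (c + v) * τ - ℕ→ℚ 4 * (c + v) * (τ - w * c)
        + c * c * (ℕ→ℚ 4 * w * (v * i - 1ℚ)) + ℕ→ℚ 4 * w * c * v * ((1ℚ + v) * i - 1ℚ)
        ≡⟨ cong (λ u → (c + (1ℚ + v)) * τ' + ℕ→ℚ 4 * (c + v) * τ - ℕ→ℚ 4 * (c + v) * (τ - w * c)
             + c * c * (ℕ→ℚ 4 * w * (v * i - 1ℚ)) + ℕ→ℚ 4 * w * c * v * (u - 1ℚ))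
             (trans (cong (_* i) (sym v+1)) (*-inv (double (suc j)))) ⟩
      (c + (1ℚ + v)) * τ' + ℕ→ℚ 4 * (c + v) * τ - ℕ→ℚ 4 * (c + v) * (τ - w * c)
        + c * c * (ℕ→ℚ 4 * w * (v * i - 1ℚ)) + ℕ→ℚ 4 * w * c * v * (1ℚ - 1ℚ)
        ≡⟨ vanish _ (ℕ→ℚ 4 * w * c * v) ⟩
      (c + (1ℚ + v)) * τ' + ℕ→ℚ 4 * (c + v) * τ - ℕ→ℚ 4 * (c + v) * (τ - w * c)
        + c * c * (ℕ→ℚ 4 * w * (v * i - 1ℚ)) ∎
      where
      expand : ∀ c v τ' τ w i → (c + (1ℚ + v)) * (τ' - w * (- ℕ→ℚ 4 * v) * i * c)
        ≡ (c + (1ℚ + v)) * τ' + ℕ→ℚ 4 * (c + v) * τ - ℕ→ℚ 4 * (c + v) * (τ - w * c)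
          + c * c * (ℕ→ℚ 4 * w * (v * i - 1ℚ)) + ℕ→ℚ 4 * w * c * v * ((1ℚ + v) * i - 1ℚ)
      expand = solve-∀ ℚ-ring
      vanish : ∀ x y → x + y * (1ℚ - 1ℚ) ≡ x
      vanish = solve-∀ ℚ-ring

  -- Closed form of the product `weight`, cleared of denominators. The factor 2 comes from S ≡ 2T,
  -- and 2(j + 1) is the residue r, standing in for the a in the denominator of the claim.
  weight-central : ∀ j → ℕ→ℚ 2 * weight j * ℕ→ℚ (double (suc j)) * central (suc j) ≡ -1^ (suc j) * 16^ (suc j)
  weight-central zero    = refl
  weight-central (suc j) = begin
    ℕ→ℚ 2 * (w * (- ℕ→ℚ 4 * v) * e) * ℕ→ℚ (double (suc (suc j))) * central (suc (suc j))
      ≡⟨ cong₂ (λ x y → ℕ→ℚ 2 * (w * (- ℕ→ℚ 4 * v) * e) * x * y) (ℕ→ℚ-double (suc (suc j))) (central-suc (suc j)) ⟩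
    ℕ→ℚ 2 * (w * (- ℕ→ℚ 4 * v) * e) * (ℕ→ℚ 2 * m) * (c * (ℕ→ℚ 2 * d) * i)
      ≡⟨ regroup w v e m c d i ⟩
    - ℕ→ℚ 16 * (ℕ→ℚ 2 * w * v * c) * (d * e) * (m * i)
      ≡⟨ cong₂ (λ x y → - ℕ→ℚ 16 * (ℕ→ℚ 2 * w * v * c) * x * y) (*-inv (double (suc j))) (*-inv (suc j)) ⟩
    - ℕ→ℚ 16 * (ℕ→ℚ 2 * w * v * c) * 1ℚ * 1ℚ
      ≡⟨ cong (λ x → - ℕ→ℚ 16 * x * 1ℚ * 1ℚ) (weight-central j) ⟩
    - ℕ→ℚ 16 * (s * P) * 1ℚ * 1ℚ
      ≡⟨ collect s P ⟩
    - 1ℚ * s * (ℕ→ℚ 16 * P)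
      ≡⟨ cong (- 1ℚ * s *_) (16^-suc (suc j)) ⟨
    - 1ℚ * s * 16^ (suc (suc j)) ∎
    where
    w = weight j
    v = ℕ→ℚ (double (suc j))
    e = inv (double (suc j))
    d = ℕ→ℚ (suc (double (suc j)))
    m = ℕ→ℚ (suc (suc j))
    i = inv (suc j)
    c = central (suc j)
    s = -1^ (suc j)
    P = 16^ (suc j)
    regroup : ∀ w v e m c d i → ℕ→ℚ 2 * (w * (- ℕ→ℚ 4 * v) * e) * (ℕ→ℚ 2 * m) * (c * (ℕ→ℚ 2 * d) * i)
      ≡ - ℕ→ℚ 16 * (ℕ→ℚ 2 * w * v * c) * (d * e) * (m * i)
    regroup = solve-∀ ℚ-ring
    collect : ∀ s P → - ℕ→ℚ 16 * (s * P) * 1ℚ * 1ℚ ≡ - 1ℚ * s * (ℕ→ℚ 16 * P)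
    collect = solve-∀ ℚ-ring

  Unit-* : ∀ {x y} → Unit x → Unit y → Unit (x * y)
  Unit-* {x} {y} (mkUnit i hi xi) (mkUnit j hj yj) = mkUnit (i * j) (Zp-* hi hj) (begin
    x * y * (i * j)      ≡⟨ regroup x y i j ⟩
    x * i * (y * j)      ≡⟨ cong₂ _*_ xi yj ⟩
    1ℚ * 1ℚ              ∎)
    where
    regroup : ∀ x y i j → x * y * (i * j) ≡ x * i * (y * j)
    regroup = solve-∀ ℚ-ring

  Unit-central : ∀ j → double j < p → Unit (central j)
  Unit-central zero    _ = mkUnit 1ℚ (Zp-ℤ (+ 1)) refl
  Unit-central (suc j) h = subst Unit (sym (central-suc j))
    (Unit-* (Unit-* (Unit-central j (ℕₚ.<⇒≤ (ℕₚ.<⇒≤ h)))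
                    (Unit-* (Unit-inv (ℕₚ.≤-trans (s≤s (s≤s (s≤s z≤n))) h)) (Unit-inv (ℕₚ.<⇒≤ h))))
            (mkUnit (ℕ→ℚ (suc j)) (Zp-ℕ (suc j)) (trans (ℚₚ.*-comm (inv j) (ℕ→ℚ (suc j))) (*-inv j))))

  -- Reduction of the sum to T, and the even case

  S : ℚ → ℚ
  S a = Σ< p (λ k → binom a k * binom a k * -1^ k * (1ℚ - (ℕ→ℚ 2 ÷₀ a) * ℕ→ℚ k))

  module _ {a : ℚ} (a-unit : Unit a) where

    private
      a⁻¹ = Unit.inverse a-unit
      a*a⁻¹ : a * a⁻¹ ≡ 1ℚ
      a*a⁻¹ = Unit.*-inverse a-unit

    -- The term left over by `weightedSum` has index p - 1, above the residue n of a - 1, so it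
    -- vanishes modulo p².
    S≡2T : ∀ {n} → suc n < p → Residue a (suc n) → M 2 (S a - ℕ→ℚ 2 * T p (a - 1ℚ))
    S≡2T {n} n<p (residue a≡) = subst (λ q → M 2 (Σ< q f - ℕ→ℚ 2 * T q (a - 1ℚ))) 1+m≡p
      (M-resp (sym (trans (cong (_- ℕ→ℚ 2 * T (suc m) (a - 1ℚ)) (weightedSum a (ℕ→ℚ 2 ÷₀ a) m 2÷a*a))
                 (cancel (ℕ→ℚ 2 * T (suc m) (a - 1ℚ)) (t (a - 1ℚ) m))))
        (M-neg (t∈M2 m a-1≡ (ℕₚ.∸-monoˡ-≤ 1 n<p) (ℕₚ.≤-reflexive 1+m≡p))))
      where
      f = λ k → binom a k * binom a k * -1^ k * (1ℚ - (ℕ→ℚ 2 ÷₀ a) * ℕ→ℚ k)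
      m = p ∸ 1
      1+m≡p : suc m ≡ p
      1+m≡p = ℕₚ.m+[n∸m]≡n {1} (ℕₚ.≤-trans (s≤s z≤n) n<p)
      cancel : ∀ x y → x - y - x ≡ - y
      cancel = solve-∀ ℚ-ring
      shift : ∀ a n → a - (1ℚ + n) ≡ a - 1ℚ - n
      shift = solve-∀ ℚ-ring
      a-1≡ : Residue (a - 1ℚ) n
      a-1≡ = residue (M-resp (trans (cong (λ u → a - u) (ℕ→ℚ-suc n)) (shift a (ℕ→ℚ n))) a≡)
      2÷a*a : ℕ→ℚ 2 ÷₀ a * a ≡ ℕ→ℚ 2
      2÷a*a = begin
        (ℕ→ℚ 2 ÷₀ a) * a       ≡⟨ cong (_* a) (÷₀-* (ℕ→ℚ 2) a a⁻¹ a*a⁻¹) ⟩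
        ℕ→ℚ 2 * a⁻¹ * a        ≡⟨ regroup a⁻¹ a ⟩
        ℕ→ℚ 2 * (a * a⁻¹)      ≡⟨ cong (ℕ→ℚ 2 *_) a*a⁻¹ ⟩
        ℕ→ℚ 2                  ∎
        where
        regroup : ∀ i a → ℕ→ℚ 2 * i * a ≡ ℕ→ℚ 2 * (a * i)
        regroup = solve-∀ ℚ-ring

    even-case : ∀ j → double (suc j) < p → Residue a (double (suc j)) →
      M 2 (S a - -1^ (suc j) * 16^ (suc j) * ((a - ℕ→ℚ (double (suc j))) ÷₀ (a * central (suc j))))
    even-case j r<p ρ@(residue a≡r) = M-resp
      (trans (cong (λ u → S a - ℕ→ℚ 2 * T p (a - 1ℚ) + (ℕ→ℚ 2 * (u - w * c) + c * (ℕ→ℚ 2 * w - sP * k)))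
                (cong (T p) c+r-1))
        (trans (regroup (S a) (T p (a - 1ℚ)) w c sP k) (cong (λ u → S a - sP * u) (sym (÷₀-* c (a * K) k aK*k)))))
      (M-+ (S≡2T r<p ρ)
        (M-+ (M-*ˡ (Zp-ℕ 2) (T-even j a≡r (ℕₚ.<⇒≤ r<p))) (M-1* a≡r final)))
      where
      w = weight j
      r = ℕ→ℚ (double (suc j))
      c = a - r
      K = central (suc j)
      K-unit = Unit-central (suc j) r<p
      sP = -1^ (suc j) * 16^ (suc j)
      aK-unit = Unit-* a-unit K-unit
      k = Unit.inverse aK-unit
      aK*k : a * K * k ≡ 1ℚ
      aK*k = Unit.*-inverse aK-unit
      c+r-1 : c + ℕ→ℚ (suc (double j)) ≡ a - 1ℚ
      c+r-1 = trans (cong (λ u → c + u) (sym (ℕ→ℚ-suc-1 (suc (double j))))) (cancel a r)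
        where
        cancel : ∀ a r → a - r + (r - 1ℚ) ≡ a - 1ℚ
        cancel = solve-∀ ℚ-ring
      regroup : ∀ S τ w c sP k → S - ℕ→ℚ 2 * τ + (ℕ→ℚ 2 * (τ - w * c) + c * (ℕ→ℚ 2 * w - sP * k)) ≡ S - sP * (c * k)
      regroup = solve-∀ ℚ-ring
      -- Both sides of the claim carry the factor c, so 2w need only agree with sP/(aK) modulo p.
      -- There a may be replaced by r, and `weight-central` gives equality.
      final : M 1 (ℕ→ℚ 2 * w - sP * k)
      final = Unit-cancel aK-unit (M-resp (sym (begin
          a * K * (ℕ→ℚ 2 * w - sP * k)
            ≡⟨ expand a K w sP k r ⟩
          (a - r) * (ℕ→ℚ 2 * w * K) + (ℕ→ℚ 2 * w * r * K - sP * (a * K * k))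
            ≡⟨ cong₂ (λ x y → (a - r) * (ℕ→ℚ 2 * w * K) + (x - sP * y)) (weight-central j) aK*k ⟩
          (a - r) * (ℕ→ℚ 2 * w * K) + (sP - sP * 1ℚ)
            ≡⟨ vanish ((a - r) * (ℕ→ℚ 2 * w * K)) sP ⟩
          (a - r) * (ℕ→ℚ 2 * w * K) ∎))
        (M-*ʳ a≡r (Zp-* (Zp-* (Zp-ℕ 2) (Zp-weight j (ℕₚ.<⇒≤ r<p))) K∈)))
        where
        K∈ : Zp K
        K∈ = Zp-binom (suc j) (Zp-ℕ (double (suc j))) (ℕₚ.≤-<-trans (n≤double (suc j)) r<p)
        expand : ∀ a K w sP k r → a * K * (ℕ→ℚ 2 * w - sP * k)
          ≡ (a - r) * (ℕ→ℚ 2 * w * K) + (ℕ→ℚ 2 * w * r * K - sP * (a * K * k))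
        expand = solve-∀ ℚ-ring
        vanish : ∀ x y → x + (y - y * 1ℚ) ≡ x
        vanish = solve-∀ ℚ-ring

  -- Odd residues

  M2⇒M1 : ∀ {x} → M 2 x → M 1 x
  M2⇒M1 (mkM z hz refl) = mkM (π * z) (Zp-* (Zp-ℕ p) hz) (begin
    ℕ→ℚ (p ℕ.^ 2) * z                ≡⟨ cong (_* z) (ℕ→ℚ-* p (p ℕ.^ 1)) ⟩
    π * ℕ→ℚ (p ℕ.^ 1) * z            ≡⟨ swap π (ℕ→ℚ (p ℕ.^ 1)) z ⟩
    ℕ→ℚ (p ℕ.^ 1) * (π * z)          ∎)
    where
    swap : ∀ x y z → x * y * z ≡ y * (x * z)
    swap = solve-∀ ℚ-ring

  -- C(u-1,k) is the product of (u - l)/l = -(1 - u/l) over l = 1, ..., k, expanded to first order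
  -- in u; the higher terms are divisible by p².
  binom-near : ∀ {u} k → M 1 u → k < p → M 2 (binom (u - 1ℚ) k - -1^ k * (1ℚ - u * H k))
  binom-near {u} zero    hu k<p = M-resp (base u) M-0
    where
    base : ∀ u → 0ℚ ≡ 1ℚ - 1ℚ * (1ℚ - u * 0ℚ)
    base = solve-∀ ℚ-ring
  binom-near {u} (suc k) hu k<p = M-resp (sym (begin
      B * (u - 1ℚ - m) * i - (- 1ℚ * s) * (1ℚ - u * (h + i))
        ≡⟨ expand B u m i s h ⟩
      (B - s * (1ℚ - u * h)) * ((u - 1ℚ - m) * i) + u * u * (- (s * h * i)) + s * (1ℚ - u * h) * (1ℚ - (1ℚ + m) * i)
        ≡⟨ cong (λ x → (B - s * (1ℚ - u * h)) * ((u - 1ℚ - m) * i) + u * u * (- (s * h * i)) + s * (1ℚ - u * h) * (1ℚ - x))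
             (trans (cong (_* i) (sym (ℕ→ℚ-suc k))) (*-inv k)) ⟩
      (B - s * (1ℚ - u * h)) * ((u - 1ℚ - m) * i) + u * u * (- (s * h * i)) + s * (1ℚ - u * h) * (1ℚ - 1ℚ)
        ≡⟨ vanish _ (s * (1ℚ - u * h)) ⟩
      (B - s * (1ℚ - u * h)) * ((u - 1ℚ - m) * i) + u * u * (- (s * h * i)) ∎))
    (M-+ (M-*ʳ (binom-near k hu k<p′) (Zp-* (Zp-- (Zp-- (M⇒Zp hu) (Zp-ℤ (+ 1))) (Zp-ℕ k)) (Zp-inv k<p)))
         (M-*ʳ (M-1* hu hu) (Zp-neg (Zp-* (Zp-* (Zp--1^ k) (Zp-H k k<p′)) (Zp-inv k<p)))))
    where
    k<p′ = ℕₚ.<⇒≤ k<p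
    B = binom (u - 1ℚ) k
    m = ℕ→ℚ k
    i = inv k
    s = -1^ k
    h = H k
    expand : ∀ B u m i s h → B * (u - 1ℚ - m) * i - (- 1ℚ * s) * (1ℚ - u * (h + i))
      ≡ (B - s * (1ℚ - u * h)) * ((u - 1ℚ - m) * i) + u * u * (- (s * h * i)) + s * (1ℚ - u * h) * (1ℚ - (1ℚ + m) * i)
    expand = solve-∀ ℚ-ring
    vanish : ∀ x y → x + y * (1ℚ - 1ℚ) ≡ x
    vanish = solve-∀ ℚ-ring

  t-near : ∀ {u} k → M 1 u → k < p → M 2 (t (u - 1ℚ) k - -1^ k * (1ℚ - ℕ→ℚ 2 * u * H k))
  t-near {u} k hu k<p = M-resp (sym (begin
      B * B * s - s * (1ℚ - ℕ→ℚ 2 * u * h)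
        ≡⟨ expand B s u h ⟩
      (B - s * e) * ((B + s * e) * s) + u * u * (s * h * h) + (s * s - 1ℚ) * (s * e * e)
        ≡⟨ cong (λ x → (B - s * e) * ((B + s * e) * s) + u * u * (s * h * h) + (x - 1ℚ) * (s * e * e)) (-1^-square k) ⟩
      (B - s * e) * ((B + s * e) * s) + u * u * (s * h * h) + (1ℚ - 1ℚ) * (s * e * e)
        ≡⟨ vanish _ (s * e * e) ⟩
      (B - s * e) * ((B + s * e) * s) + u * u * (s * h * h) ∎))
    (M-+ (M-*ʳ (binom-near k hu k<p) (Zp-* (Zp-+ (Zp-binom k u-1∈ k<p)
                (Zp-* (Zp--1^ k) (Zp-- (Zp-ℤ (+ 1)) (Zp-* (M⇒Zp hu) (Zp-H k k<p))))) (Zp--1^ k)))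
         (M-*ʳ (M-1* hu hu) (Zp-* (Zp-* (Zp--1^ k) (Zp-H k k<p)) (Zp-H k k<p))))
    where
    B = binom (u - 1ℚ) k
    s = -1^ k
    h = H k
    e = 1ℚ - u * h
    u-1∈ : Zp (u - 1ℚ)
    u-1∈ = Zp-- (M⇒Zp hu) (Zp-ℤ (+ 1))
    expand : ∀ B s u h → B * B * s - s * (1ℚ - ℕ→ℚ 2 * u * h)
      ≡ (B - s * (1ℚ - u * h)) * ((B + s * (1ℚ - u * h)) * s) + u * u * (s * h * h)
        + (s * s - 1ℚ) * (s * (1ℚ - u * h) * (1ℚ - u * h))
    expand = solve-∀ ℚ-ring
    vanish : ∀ x y → x + (1ℚ - 1ℚ) * y ≡ x
    vanish = solve-∀ ℚ-ring

  -- Consecutive terms pair off: −H₂ₖ₋₁ + H₂ₖ = 1/(2k).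
  T-near : ∀ {u} n → M 1 u → double n < p → M 2 (T (suc (double n)) (u - 1ℚ) - (1ℚ - u * H n))
  T-near {u} zero    hu h = M-resp (base u) M-0
    where
    base : ∀ u → 0ℚ ≡ 0ℚ + 1ℚ * 1ℚ * 1ℚ - (1ℚ - u * 0ℚ)
    base = solve-∀ ℚ-ring
  T-near {u} (suc n) hu h = M-resp (begin
      τ - (1ℚ - u * η) + (t₁ - (- 1ℚ * s) * (1ℚ - ℕ→ℚ 2 * u * h₁)) + (t₂ - (- 1ℚ * (- 1ℚ * s)) * (1ℚ - ℕ→ℚ 2 * u * (h₁ + e)))
        ≡⟨ cong (λ x → τ - (1ℚ - u * η) + (t₁ - (- 1ℚ * x) * (1ℚ - ℕ→ℚ 2 * u * h₁)) + (t₂ - (- 1ℚ * (- 1ℚ * x)) * (1ℚ - ℕ→ℚ 2 * u * (h₁ + e)))) (-1^-double n) ⟩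
      τ - (1ℚ - u * η) + (t₁ - (- 1ℚ * 1ℚ) * (1ℚ - ℕ→ℚ 2 * u * h₁)) + (t₂ - (- 1ℚ * (- 1ℚ * 1ℚ)) * (1ℚ - ℕ→ℚ 2 * u * (h₁ + e)))
        ≡⟨ collect τ u η t₁ t₂ h₁ e ⟩
      τ + t₁ + t₂ - (1ℚ - u * (η + ℕ→ℚ 2 * e))
        ≡⟨ cong (λ x → τ + t₁ + t₂ - (1ℚ - u * (η + x))) (inv-double n) ⟨
      τ + t₁ + t₂ - (1ℚ - u * (η + inv n)) ∎)
    (M-+ (M-+ (T-near n hu (ℕₚ.<⇒≤ (ℕₚ.<⇒≤ h))) (t-near (suc (double n)) hu (ℕₚ.<⇒≤ h))) (t-near (suc (suc (double n))) hu h))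
    where
    τ = T (suc (double n)) (u - 1ℚ)
    t₁ = t (u - 1ℚ) (suc (double n))
    t₂ = t (u - 1ℚ) (suc (suc (double n)))
    s = -1^ (double n)
    η = H n
    h₁ = H (suc (double n))
    e = inv (suc (double n))
    collect : ∀ τ u η t₁ t₂ h₁ e →
      τ - (1ℚ - u * η) + (t₁ - (- 1ℚ * 1ℚ) * (1ℚ - ℕ→ℚ 2 * u * h₁)) + (t₂ - (- 1ℚ * (- 1ℚ * 1ℚ)) * (1ℚ - ℕ→ℚ 2 * u * (h₁ + e)))
      ≡ τ + t₁ + t₂ - (1ℚ - u * (η + ℕ→ℚ 2 * e))
    collect = solve-∀ ℚ-ring

  -- Sums of binomials and harmonic numbers modulo p

  binom-near₁ : ∀ {u} k → M 1 u → k < p → M 1 (binom (u - 1ℚ) k - -1^ k)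
  binom-near₁ {u} k hu k<p = M-resp (regroup (binom (u - 1ℚ) k) (-1^ k) u (H k))
    (M-- (M2⇒M1 (binom-near k hu k<p)) (M-*ʳ hu (Zp-* (Zp--1^ k) (Zp-H k k<p))))
    where
    regroup : ∀ B s u h → B - s * (1ℚ - u * h) - u * (s * h) ≡ B - s
    regroup = solve-∀ ℚ-ring

  -- Modulo p the terms alternate 1, -1, ..., 1, and their number is odd.
  Σ-binom-near : ∀ {u} n → M 1 u → double n < p → M 1 (Σ< (suc (double n)) (binom (u - 1ℚ)) - 1ℚ)
  Σ-binom-near zero    hu h = M-0
  Σ-binom-near {u} (suc n) hu h = M-resp (regroup A B D (-1^ (double n)))
    (M-+ (M-+ (Σ-binom-near n hu (ℕₚ.<⇒≤ (ℕₚ.<⇒≤ h))) (binom-near₁ (suc (double n)) hu (ℕₚ.<⇒≤ h)))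
         (binom-near₁ (suc (suc (double n))) hu h))
    where
    A = Σ< (suc (double n)) (binom (u - 1ℚ))
    B = binom (u - 1ℚ) (suc (double n))
    D = binom (u - 1ℚ) (suc (suc (double n)))
    regroup : ∀ A B D s → A - 1ℚ + (B - (- 1ℚ * s)) + (D - (- 1ℚ * (- 1ℚ * s))) ≡ A + B + D - 1ℚ
    regroup = solve-∀ ℚ-ring

  inv-pair : ∀ j k → suc j ℕ.+ suc k ≡ p → M 1 (inv j + inv k)
  inv-pair j k j+k≡p = M-resp (begin
      π * (x * y)                    ≡⟨ cong (λ m → ℕ→ℚ m * (x * y)) (sym j+k≡p) ⟩
      ℕ→ℚ (suc j ℕ.+ suc k) * (x * y) ≡⟨ cong (_* (x * y)) (ℕ→ℚ-+ (suc j) (suc k)) ⟩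
      (a + b) * (x * y)              ≡⟨ expand a b x y ⟩
      a * x * y + b * y * x          ≡⟨ cong₂ (λ u v → u * y + v * x) (*-inv j) (*-inv k) ⟩
      1ℚ * y + 1ℚ * x                ≡⟨ collect x y ⟩
      x + y                          ∎)
    (M-*ʳ π∈M1 (Zp-* (Zp-inv j<p) (Zp-inv k<p)))
    where
    x = inv j
    y = inv k
    a = ℕ→ℚ (suc j)
    b = ℕ→ℚ (suc k)
    j<p : suc j < p
    j<p = subst (suc j <_) j+k≡p (ℕₚ.m<m+n (suc j) (s≤s z≤n))
    k<p : suc k < p
    k<p = subst (suc k <_) j+k≡p (ℕₚ.m<n+m (suc k) (s≤s z≤n))
    expand : ∀ a b x y → (a + b) * (x * y) ≡ a * x * y + b * y * x
    expand = solve-∀ ℚ-ring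
    collect : ∀ x y → 1ℚ * y + 1ℚ * x ≡ x + y
    collect = solve-∀ ℚ-ring

  -- The terms 1/(k + 1), ..., 1/(p - 1) are 1/(p - l) ≡ -1/l for l = j, ..., 1. The induction
  -- trades j against k, keeping j + k = p - 1.
  H-reflection : ∀ j k → suc (j ℕ.+ k) ≡ p → M 1 (H (j ℕ.+ k) - H k + H j)
  H-reflection zero    k eq = M-resp (cancel (H k)) M-0
    where
    cancel : ∀ x → 0ℚ ≡ x - x + 0ℚ
    cancel = solve-∀ ℚ-ring
  H-reflection (suc j) k eq = M-resp (regroup (H (suc (j ℕ.+ k))) (H k) (H j) (inv j) (inv k))
    (M-+ (subst (λ m → M 1 (H m - H (suc k) + H j)) (ℕₚ.+-suc j k)
           (H-reflection j (suc k) (trans (cong suc (ℕₚ.+-suc j k)) eq)))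
         (inv-pair j k (trans (cong suc (ℕₚ.+-suc j k)) eq)))
    where
    regroup : ∀ A x y i k → A - (x + k) + y + (i + k) ≡ A - x + (y + i)
    regroup = solve-∀ ℚ-ring

  -- The increments in N are reciprocals whose denominators pair off to sum p.
  H-balance : ∀ {n} N m → p ≡ suc (double n) → N ℕ.+ m ≡ n →
    M 1 (H n + H (double m) - H m + (H (double N) - H N))
  H-balance zero m p≡ refl = M-resp (trans (cong (λ k → H k - H m + H m) (sym (double≡+ m))) (regroup (H m) (H (double m))))
    (H-reflection m m (trans (cong suc (sym (double≡+ m))) (sym p≡)))
    where
    regroup : ∀ x y → y - x + x ≡ x + y - x + (0ℚ - 0ℚ)
    regroup = solve-∀ ℚ-ring
  H-balance {n} (suc N) m p≡ N+m≡n = M-resp (begin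
      η + (D + i₁ + i₂) - (x + inv m) + (E - y) - (i₁ + k₂) + (k₁ + i₂)
        ≡⟨ cong (λ z → η + (D + i₁ + i₂) - (x + z) + (E - y) - (i₁ + k₂) + (k₁ + i₂)) (inv-double m) ⟩
      η + (D + i₁ + i₂) - (x + ℕ→ℚ 2 * i₂) + (E - y) - (i₁ + k₂) + (k₁ + i₂)
        ≡⟨ collect η D i₁ i₂ x E y k₁ k₂ ⟩
      η + D - x + (E + k₁ + k₂ - (y + ℕ→ℚ 2 * k₂))
        ≡⟨ cong (λ z → η + D - x + (E + k₁ + k₂ - (y + z))) (inv-double N) ⟨
      η + D - x + (E + k₁ + k₂ - (y + inv N)) ∎)
    (M-+ (M-- (H-balance N (suc m) p≡ (trans (ℕₚ.+-suc N m) N+m≡n))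
              (inv-pair (double m) (suc (double N)) sum₁))
         (inv-pair (double N) (suc (double m)) sum₂))
    where
    η = H n
    D = H (double m)
    E = H (double N)
    x = H m
    y = H N
    i₁ = inv (double m)
    i₂ = inv (suc (double m))
    k₁ = inv (double N)
    k₂ = inv (suc (double N))
    p≡′ : suc (suc (suc (double N ℕ.+ double m))) ≡ p
    p≡′ = sym (trans p≡ (cong suc (trans (cong double (sym N+m≡n)) (cong (λ k → suc (suc k)) (double-+ N m)))))
    sum₂ : suc (double N) ℕ.+ suc (suc (double m)) ≡ p
    sum₂ = trans (cong suc (trans (ℕₚ.+-suc (double N) (suc (double m))) (cong suc (ℕₚ.+-suc (double N) (double m))))) p≡′
    sum₁ : suc (double m) ℕ.+ suc (suc (double N)) ≡ p
    sum₁ = trans (cong suc (trans (ℕₚ.+-suc (double m) (suc (double N))) (cong suc (trans (ℕₚ.+-suc (double m) (double N)) (cong suc (ℕₚ.+-comm (double m) (double N))))))) p≡′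
    collect : ∀ η D i₁ i₂ x E y k₁ k₂ →
      η + (D + i₁ + i₂) - (x + ℕ→ℚ 2 * i₂) + (E - y) - (i₁ + k₂) + (k₁ + i₂)
      ≡ η + D - x + (E + k₁ + k₂ - (y + ℕ→ℚ 2 * k₂))
    collect = solve-∀ ℚ-ring

  -- The Fermat quotient and the descent by steps of two

  module OddPrime (n : ℕ) (p≡1+2n : p ≡ suc (double n)) where

    2n<p : double n < p
    2n<p = ℕₚ.≤-reflexive (sym p≡1+2n)

    n<p : n < p
    n<p = ℕₚ.≤-<-trans (n≤double n) 2n<p

    π-1 : π - 1ℚ ≡ ℕ→ℚ (double n)
    π-1 = trans (cong (λ k → ℕ→ℚ k - 1ℚ) p≡1+2n) (ℕ→ℚ-suc-1 (double n))

    p-1≡2n : p ∸ 1 ≡ double n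
    p-1≡2n = cong (_∸ 1) p≡1+2n

    -- 2^(p-1) is the sum of the C(p-1,k), which `Σ-binom-near` evaluates modulo p at u = p. This
    -- yields the p-integrality of `qp2 p`.
    fermat : M 1 (ℕ→ℚ (2 ℕ.^ (p ∸ 1)) - 1ℚ)
    fermat = M-resp (cong (_- 1ℚ) (begin
        Σ< (suc (double n)) (binom (π - 1ℚ))            ≡⟨ cong (λ b → Σ< (suc (double n)) (binom b)) π-1 ⟩
        Σ< (suc (double n)) (binom (ℕ→ℚ (double n)))    ≡⟨ Σ-binom (double n) ⟩
        ℕ→ℚ (2 ℕ.^ double n)                            ≡⟨ cong (λ k → ℕ→ℚ (2 ℕ.^ k)) p-1≡2n ⟨
        ℕ→ℚ (2 ℕ.^ (p ∸ 1))                             ∎))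
      (Σ-binom-near n π∈M1 2n<p)

    private
      π⁻¹ = inv (double n)

      π*π⁻¹ : π * π⁻¹ ≡ 1ℚ
      π*π⁻¹ = trans (cong (λ k → ℕ→ℚ k * π⁻¹) p≡1+2n) (*-inv (double n))

    π*qp2 : π * qp2 p ≡ ℕ→ℚ (2 ℕ.^ (p ∸ 1)) - 1ℚ
    π*qp2 = begin
      π * qp2 p                ≡⟨ cong (π *_) (÷₀-* x π π⁻¹ π*π⁻¹) ⟩
      π * (x * π⁻¹)            ≡⟨ regroup π x π⁻¹ ⟩
      π * π⁻¹ * x              ≡⟨ cong (_* x) π*π⁻¹ ⟩
      1ℚ * x                   ≡⟨ ℚₚ.*-identityˡ x ⟩
      x                        ∎
      where
      x = ℕ→ℚ (2 ℕ.^ (p ∸ 1)) - 1ℚ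
      regroup : ∀ q x i → q * (x * i) ≡ q * i * x
      regroup = solve-∀ ℚ-ring

    Zp-qp2 : Zp (qp2 p)
    Zp-qp2 = divide (M-resp (sym π*qp2) fermat)
      where
      undo : ∀ y → π * y * π⁻¹ ≡ y
      undo y = trans (regroup π y π⁻¹) (trans (cong (_* y) π*π⁻¹) (ℚₚ.*-identityˡ y))
        where
        regroup : ∀ q y i → q * y * i ≡ q * i * y
        regroup = solve-∀ ℚ-ring
      inverse-cancel : ∀ {y z} → π * y ≡ π * z → y ≡ z
      inverse-cancel {y} {z} eq = trans (sym (undo y)) (trans (cong (_* π⁻¹) eq) (undo z))
      divide : ∀ {y} → M 1 (π * y) → Zp y
      divide (mkM z hz eq) = subst Zp (inverse-cancel (sym (trans eq (cong (λ k → ℕ→ℚ k * z) (ℕₚ.*-identityʳ p))))) hz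

    -- `Residue` takes a natural representative, so -1 - k is presented as p - 1 - k.
    Residue-below : ∀ {u} k m → suc (k ℕ.+ m) ≡ p → M 1 u → Residue (u - 1ℚ - ℕ→ℚ k) m
    Residue-below {u} k m eq hu = residue (M-resp (begin
        u - π                                  ≡⟨ cong (λ q → u - ℕ→ℚ q) (sym eq) ⟩
        u - ℕ→ℚ (suc (k ℕ.+ m))                ≡⟨ cong (λ x → u - x) (trans (ℕ→ℚ-suc (k ℕ.+ m)) (cong (λ x → 1ℚ + x) (ℕ→ℚ-+ k m))) ⟩
        u - (1ℚ + (ℕ→ℚ k + ℕ→ℚ m))             ≡⟨ regroup u (ℕ→ℚ k) (ℕ→ℚ m) ⟩
        u - 1ℚ - ℕ→ℚ k - ℕ→ℚ m                 ∎) (M-- hu π∈M1))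
      where
      regroup : ∀ u x y → u - (1ℚ + (x + y)) ≡ u - 1ℚ - x - y
      regroup = solve-∀ ℚ-ring

    -- The first-order coefficient after i steps of descent. It starts at H n, and each step adds
    -- 1/(2i + 1) - 1/(2i + 2), from the u-expansion of (2i + 1 - u)/(2i + 2 - u).
    L : ℕ → ℚ
    L i = H n + H (double i) - H i

    Zp-L : ∀ i → double i < p → Zp (L i)
    Zp-L i h = Zp-- (Zp-+ (Zp-H n n<p) (Zp-H (double i) h))
      (Zp-H i (ℕₚ.≤-<-trans (n≤double i) h))

    Zp-central : ∀ i → double i < p → Zp (central i)
    Zp-central i h = Zp-binom i (Zp-ℕ (double i))
      (ℕₚ.≤-<-trans (n≤double i) h)

    Zp-16^ : ∀ i → Zp (16^ i)
    Zp-16^ i = Zp-ℕ (2 ℕ.^ (2 ℕ.* double i))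

    -- With v = 2i, a step down multiplies T by -(1/4)(1 + v - u)/(2 + v - u). At u = 0 the
    -- quotients multiply to `central i` / 4^i, and the factors -1/4 to (-1)^i / 4^i.
    T-odd : ∀ {u} i → M 1 u → double i < p →
      M 2 (-1^ i * 16^ i * T p (u - 1ℚ - ℕ→ℚ (double i)) - central i * (1ℚ - u * L i))
    T-odd {u} zero hu _ = M-resp (begin
        T (suc (double n)) (u - 1ℚ) - (1ℚ - u * η)
          ≡⟨ cong₂ (λ k b → T k b - (1ℚ - u * η)) (sym p≡1+2n) (sub0 u) ⟩
        T p (u - 1ℚ - 0ℚ) - (1ℚ - u * η)
          ≡⟨ base (T p (u - 1ℚ - 0ℚ)) u η ⟩
        1ℚ * 1ℚ * T p (u - 1ℚ - 0ℚ) - 1ℚ * (1ℚ - u * (η + 0ℚ - 0ℚ)) ∎)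
      (T-near n hu 2n<p)
      where
      η = H n
      sub0 : ∀ u → u - 1ℚ ≡ u - 1ℚ - 0ℚ
      sub0 = solve-∀ ℚ-ring
      base : ∀ τ u η → τ - (1ℚ - u * η) ≡ 1ℚ * 1ℚ * τ - 1ℚ * (1ℚ - u * (η + 0ℚ - 0ℚ))
      base = solve-∀ ℚ-ring
    T-odd {u} (suc i) hu h = Unit-cancel (Unit-near {ℕ→ℚ 2 + v - u} h 2+v-u)
      (M-resp (sym identity) (M-+ (M-- (M-*ˡ (Zp-* (Zp-ℕ 4) (Zp-* (Zp--1^ i) (Zp-16^ i))) step)
                                       (M-*ˡ (Zp-* (Zp-ℕ 4) (Zp-- (Zp-- hu∈ (Zp-ℤ (+ 1))) (Zp-ℕ (double i)))) (T-odd i hu h′)))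
                                  (M-*ʳ (M-1* hu hu) rest)))
      where
      h′ = ℕₚ.<⇒≤ (ℕₚ.<⇒≤ h)
      hu∈ = M⇒Zp hu
      v = ℕ→ℚ (double i)
      s = -1^ i
      P = 16^ i
      K = central i
      j = inv i
      e = inv (suc (double i))
      f = inv (double i)
      η = H n
      A = H (double i)
      B = H i
      τ = T p (u - 1ℚ - v)
      τ' = T p (u - 1ℚ - ℕ→ℚ (double (suc i)))
      2+v : ℕ→ℚ (double (suc i)) ≡ ℕ→ℚ 2 + v
      2+v = ℕ→ℚ-2+ (double i)
      Λ = L i + f - e
      rest : Zp (ℕ→ℚ 4 * K * (L i - (1ℚ + v) * e * Λ))
      rest = Zp-* (Zp-* (Zp-ℕ 4) (Zp-central i h′)) (Zp-- (Zp-L i h′)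
        (Zp-* (Zp-* (Zp-+ (Zp-ℤ (+ 1)) (Zp-ℕ (double i))) (Zp-inv h))
          (Zp-- (Zp-+ (Zp-L i h′) (Zp-inv (ℕₚ.<⇒≤ h))) (Zp-inv h))))
      -- The coefficient u - 2 - v is negated so that its residue is the natural number 2i + 2 < p,
      -- a unit.
      2+v-u : Residue (ℕ→ℚ 2 + v - u) (double (suc i))
      2+v-u = residue (M-resp (trans (negate u (ℕ→ℚ 2 + v)) (cong (λ x → ℕ→ℚ 2 + v - u - x) (sym 2+v))) (M-neg hu))
        where
        negate : ∀ u x → - u ≡ x - u - x
        negate = solve-∀ ℚ-ring
      m = p ∸ suc (double (suc i))
      2i+2+m : suc (double (suc i) ℕ.+ m) ≡ p
      2i+2+m = ℕₚ.m+[n∸m]≡n h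
      m+3≤p : suc (suc (suc m)) ≤ p
      m+3≤p = subst (suc (suc (suc m)) ≤_) 2i+2+m (s≤s (s≤s (s≤s (ℕₚ.m≤n+m m (double i)))))
      step : M 2 ((u - 1ℚ - v) * τ + ℕ→ℚ 4 * (u - ℕ→ℚ 2 - v) * τ')
      step = M-resp
        (cong₂ _+_
          (cong₂ _*_ (trans (cong (λ x → u - 1ℚ - x + ℕ→ℚ 2) 2+v) (plus2 u v))
                     (cong (T p) (trans (cong (λ x → u - 1ℚ - x + 1ℚ + 1ℚ) 2+v) (plus11 u v))))
          (cong (λ x → ℕ→ℚ 4 * x * τ') (trans (cong (λ x → u - 1ℚ - x + 1ℚ) 2+v) (plus1 u v))))
        (T-step (Residue-below (double (suc i)) m 2i+2+m hu) m+3≤p)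
        where
        plus2 : ∀ u v → u - 1ℚ - (ℕ→ℚ 2 + v) + ℕ→ℚ 2 ≡ u - 1ℚ - v
        plus2 = solve-∀ ℚ-ring
        plus11 : ∀ u v → u - 1ℚ - (ℕ→ℚ 2 + v) + 1ℚ + 1ℚ ≡ u - 1ℚ - v
        plus11 = solve-∀ ℚ-ring
        plus1 : ∀ u v → u - 1ℚ - (ℕ→ℚ 2 + v) + 1ℚ ≡ u - ℕ→ℚ 2 - v
        plus1 = solve-∀ ℚ-ring
      W₀ = ℕ→ℚ 4 * (s * P) * ((u - 1ℚ - v) * τ + ℕ→ℚ 4 * (u - ℕ→ℚ 2 - v) * τ')
        - ℕ→ℚ 4 * (u - 1ℚ - v) * (s * P * τ - K * (1ℚ - u * L i))
      W = W₀ + u * u * (ℕ→ℚ 4 * K * (L i - (1ℚ + v) * e * Λ))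
      identity : (ℕ→ℚ 2 + v - u) * (-1^ (suc i) * 16^ (suc i) * τ' - central (suc i) * (1ℚ - u * L (suc i))) ≡ W
      identity = begin
        (ℕ→ℚ 2 + v - u) * (- 1ℚ * s * 16^ (suc i) * τ' - central (suc i) * (1ℚ - u * (η + (A + f + e) - (B + j))))
          ≡⟨ cong₂ (λ x y → (ℕ→ℚ 2 + v - u) * (- 1ℚ * s * x * τ' - y * (1ℚ - u * (η + (A + f + e) - (B + j)))))
               (16^-suc i) (central-suc i) ⟩
        (ℕ→ℚ 2 + v - u) * (- 1ℚ * s * (ℕ→ℚ 16 * P) * τ' - K * (ℕ→ℚ 2 * ℕ→ℚ (suc (double i))) * j * (1ℚ - u * (η + (A + f + e) - (B + j))))
          ≡⟨ cong₂ (λ x y → (ℕ→ℚ 2 + v - u) * (- 1ℚ * s * (ℕ→ℚ 16 * P) * τ' - K * (ℕ→ℚ 2 * x) * y * (1ℚ - u * (η + (A + f + e) - (B + y)))))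
               (ℕ→ℚ-suc (double i)) (inv-double i) ⟩
        (ℕ→ℚ 2 + v - u) * (- 1ℚ * s * (ℕ→ℚ 16 * P) * τ' - K * (ℕ→ℚ 2 * (1ℚ + v)) * (ℕ→ℚ 2 * e) * (1ℚ - u * (η + (A + f + e) - (B + ℕ→ℚ 2 * e))))
          ≡⟨ cong (λ x → (ℕ→ℚ 2 + v - u) * (- 1ℚ * s * (ℕ→ℚ 16 * P) * τ' - K * (ℕ→ℚ 2 * (1ℚ + v)) * (ℕ→ℚ 2 * e) * (1ℚ - u * x)))
               (simplify η A B e f) ⟩
        (ℕ→ℚ 2 + v - u) * (- 1ℚ * s * (ℕ→ℚ 16 * P) * τ' - K * (ℕ→ℚ 2 * (1ℚ + v)) * (ℕ→ℚ 2 * e) * (1ℚ - u * (L i + f - e)))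
          ≡⟨ eliminate u v s P τ τ' (K * (1ℚ - u * L i)) (K * (ℕ→ℚ 2 * (1ℚ + v)) * (ℕ→ℚ 2 * e) * (1ℚ - u * (L i + f - e))) ⟩
        W₀ + (ℕ→ℚ 4 * (1ℚ + v - u) * (K * (1ℚ - u * L i)) - (ℕ→ℚ 2 + v - u) * (K * (ℕ→ℚ 2 * (1ℚ + v)) * (ℕ→ℚ 2 * e) * (1ℚ - u * (L i + f - e))))
          -- Beyond the recurrence and the induction hypothesis collected in `W₀`, there remain a
          -- multiple of u² and multiples of (2 + v) e - 1 and (1 + v) f - 1, which are zero since e
          -- = 1/(2i + 2) and f = 1/(2i + 1).
          ≡⟨ cong (λ x → W₀ + x) (trans (factor u v K e (L i) (L i + f - e)) (cong (λ x → ℕ→ℚ 4 * K * x) (expand u v e f (L i)))) ⟩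
        W₀ + ℕ→ℚ 4 * K * (u * u * (L i - (1ℚ + v) * e * Λ)
          + (- ((1ℚ + v) * (1ℚ - u * Λ)) * ((ℕ→ℚ 2 + v) * e - 1ℚ) + u * ((1ℚ + v) * f - 1ℚ)))
          ≡⟨ regroup W₀ (ℕ→ℚ 4 * K) (u * u) (L i - (1ℚ + v) * e * Λ) _ ⟩
        W + ℕ→ℚ 4 * K * (- ((1ℚ + v) * (1ℚ - u * Λ)) * ((ℕ→ℚ 2 + v) * e - 1ℚ) + u * ((1ℚ + v) * f - 1ℚ))
          ≡⟨ cong₂ (λ x y → W + ℕ→ℚ 4 * K * (- ((1ℚ + v) * (1ℚ - u * Λ)) * (x - 1ℚ) + u * (y - 1ℚ)))
               (trans (cong (_* e) (sym 2+v)) (*-inv (suc (double i))))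
               (trans (cong (_* f) (sym (ℕ→ℚ-suc (double i)))) (*-inv (double i))) ⟩
        W + ℕ→ℚ 4 * K * (- ((1ℚ + v) * (1ℚ - u * Λ)) * (1ℚ - 1ℚ) + u * (1ℚ - 1ℚ))
          ≡⟨ vanish W (ℕ→ℚ 4 * K) (- ((1ℚ + v) * (1ℚ - u * Λ))) u ⟩
        W ∎
        where
        simplify : ∀ η A B e f → η + (A + f + e) - (B + ℕ→ℚ 2 * e) ≡ η + A - B + f - e
        simplify = solve-∀ ℚ-ring
        eliminate : ∀ u v s P τ τ' Y X →
          (ℕ→ℚ 2 + v - u) * (- 1ℚ * s * (ℕ→ℚ 16 * P) * τ' - X)
          ≡ ℕ→ℚ 4 * (s * P) * ((u - 1ℚ - v) * τ + ℕ→ℚ 4 * (u - ℕ→ℚ 2 - v) * τ')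
            - ℕ→ℚ 4 * (u - 1ℚ - v) * (s * P * τ - Y)
            + (ℕ→ℚ 4 * (1ℚ + v - u) * Y - (ℕ→ℚ 2 + v - u) * X)
        eliminate = solve-∀ ℚ-ring
        factor : ∀ u v K e l Λ →
          ℕ→ℚ 4 * (1ℚ + v - u) * (K * (1ℚ - u * l)) - (ℕ→ℚ 2 + v - u) * (K * (ℕ→ℚ 2 * (1ℚ + v)) * (ℕ→ℚ 2 * e) * (1ℚ - u * Λ))
          ≡ ℕ→ℚ 4 * K * ((1ℚ + v - u) * (1ℚ - u * l) - (ℕ→ℚ 2 + v - u) * (1ℚ + v) * e * (1ℚ - u * Λ))
        factor = solve-∀ ℚ-ring
        expand : ∀ u v e f l →
          (1ℚ + v - u) * (1ℚ - u * l) - (ℕ→ℚ 2 + v - u) * (1ℚ + v) * e * (1ℚ - u * (l + f - e))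
          ≡ u * u * (l - (1ℚ + v) * e * (l + f - e))
            + (- ((1ℚ + v) * (1ℚ - u * (l + f - e))) * ((ℕ→ℚ 2 + v) * e - 1ℚ) + u * ((1ℚ + v) * f - 1ℚ))
        expand = solve-∀ ℚ-ring
        regroup : ∀ w k q x y → w + k * (q * x + y) ≡ w + q * (k * x) + k * y
        regroup = solve-∀ ℚ-ring
        vanish : ∀ w k x u → w + k * (x * (1ℚ - 1ℚ) + u * (1ℚ - 1ℚ)) ≡ w
        vanish = solve-∀ ℚ-ring

  -- Assembly of the odd case

  Unit-2^ : ∀ k → 2 < p → Unit (ℕ→ℚ (2 ℕ.^ k))
  Unit-2^ zero    _ = mkUnit 1ℚ (Zp-ℤ (+ 1)) refl
  Unit-2^ (suc k) h = subst Unit (sym (ℕ→ℚ-* 2 (2 ℕ.^ k))) (Unit-* (Unit-inv h) (Unit-2^ k h))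

  module _ {a : ℚ} (a-unit : Unit a) where

    -- After multiplication by the unit 2a · 16^i three congruences chain: S ≡ 2T(a - 1), 4a T(a -
    -- 1) ≡ -(a + 1) T(a + 1), and `T-odd` at a + 1. The indices satisfy p - 2 - r = 2i.
    odd-case : ∀ m i → p ≡ suc (double (suc m ℕ.+ i)) → Residue a (suc (double m)) →
      let r = suc (double m) in
      M 2 (S a - ((a + 1ℚ) ÷₀ a) * -1^ (suc i) * ℕ→ℚ (2 ℕ.^ (2 ℕ.* r ℕ.+ 1)) * central i
             * (1ℚ - ℕ→ℚ 2 * π * qp2 p + (π + a - ℕ→ℚ r) * (H (double (suc m)) - H (suc m))))
    odd-case m i p≡ a≡r@(residue a≡r′) = Unit-cancel U-unit (M-resp (sym identity)
        (M-+ (M-- (M-+ (M-*ˡ (Zp-* (Zp-* (Zp-ℕ 2) a∈) P∈) (S≡2T a-unit (ℕₚ.<⇒≤ r+2≤p) a≡r))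
                       (M-*ˡ P∈ E∈))
                  (M-*ˡ (Zp-* a+1∈ s∈) V∈))
             (M-*ˡ (Zp-* (Zp-* a+1∈ s∈) K∈)
               (M-+ (M-+ (M-1* u∈ κ+L∈) (M-*ʳ (M-1* x∈ u∈) (Zp-* (Zp-ℕ 2) κ∈)))
                    (M-*ʳ (M-1* x∈ x∈) (Zp-- (Zp-- (Zp-* u∈₀ κ∈) (Zp-* (Zp-ℕ 2) x∈₀)) (Zp-ℕ 3)))))))
      where
      n = suc m ℕ.+ i
      open OddPrime n p≡
      r = suc (double m)
      -- Since p = r + 2 + 2i, this is the u with u - 1 - 2i = a + 1: the descent from u - 1 reaches
      -- a + 1 after i steps.
      u = π + a - ℕ→ℚ r
      v = ℕ→ℚ (double i)
      τ = T p (a + 1ℚ)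
      τ' = T p (a - 1ℚ)
      s = -1^ i
      P = 16^ i
      K = central i
      Z = ℕ→ℚ (2 ℕ.^ (2 ℕ.* r ℕ.+ 1))
      κ = H (double (suc m)) - H (suc m)
      x = π * qp2 p
      a⁻¹ = Unit.inverse a-unit

      r+2+2i≡p : suc r ℕ.+ suc (double i) ≡ p
      r+2+2i≡p = sym (trans p≡ (cong suc (trans (cong (λ k → suc (suc k)) (double-+ m i)) (cong suc (sym (ℕₚ.+-suc (double m) (double i)))))))
      r+2≤p : suc (suc r) ≤ p
      r+2≤p = subst (suc (suc r) ≤_) r+2+2i≡p (s≤s (subst (suc r ≤_) (sym (ℕₚ.+-suc r (double i))) (s≤s (ℕₚ.m≤m+n r (double i)))))
      2i<p : double i < p
      2i<p = subst (double i <_) r+2+2i≡p (ℕₚ.m≤n+m (suc (double i)) (suc r))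
      2N<p : double (suc m) < p
      2N<p = r+2≤p
      2<p : 2 < p
      2<p = ℕₚ.≤-trans (s≤s (s≤s (s≤s z≤n))) r+2≤p

      a∈ : Zp a
      a∈ = Zp-near a≡r
      a+1∈ : Zp (a + 1ℚ)
      a+1∈ = Zp-+ a∈ (Zp-ℤ (+ 1))
      P∈ : Zp P
      P∈ = Zp-16^ i
      s∈ : Zp s
      s∈ = Zp--1^ i
      K∈ : Zp K
      K∈ = Zp-central i 2i<p
      x∈ : M 1 x
      x∈ = M-*ʳ π∈M1 Zp-qp2
      x∈₀ : Zp x
      x∈₀ = M⇒Zp x∈
      κ∈ : Zp κ
      κ∈ = Zp-- (Zp-H (double (suc m)) 2N<p) (Zp-H (suc m) (ℕₚ.≤-<-trans (n≤double (suc m)) 2N<p))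
      u∈ : M 1 u
      u∈ = M-resp (regroup π a (ℕ→ℚ r)) (M-+ π∈M1 a≡r′)
        where
        regroup : ∀ q a r → q + (a - r) ≡ q + a - r
        regroup = solve-∀ ℚ-ring
      u∈₀ : Zp u
      u∈₀ = M⇒Zp u∈
      -- `L i` occurs multiplied by u, so it is needed only modulo p, where it is -κ.
      κ+L∈ : M 1 (κ + L i)
      κ+L∈ = M-resp (ℚₚ.+-comm (L i) κ) (H-balance (suc m) i p≡ refl)

      u-1-v : u - 1ℚ - v ≡ a + 1ℚ
      u-1-v = begin
        π + a - ℕ→ℚ r - 1ℚ - v
          ≡⟨ cong (λ k → k + a - ℕ→ℚ r - 1ℚ - v) (trans (cong ℕ→ℚ (sym r+2+2i≡p)) (trans (ℕ→ℚ-+ (suc r) (suc (double i)))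
               (cong₂ _+_ (ℕ→ℚ-suc r) (ℕ→ℚ-suc (double i))))) ⟩
        1ℚ + ℕ→ℚ r + (1ℚ + v) + a - ℕ→ℚ r - 1ℚ - v
          ≡⟨ cancel a (ℕ→ℚ r) v ⟩
        a + 1ℚ ∎
        where
        cancel : ∀ a r v → 1ℚ + r + (1ℚ + v) + a - r - 1ℚ - v ≡ a + 1ℚ
        cancel = solve-∀ ℚ-ring

      V∈ : M 2 (s * P * τ - K * (1ℚ - u * L i))
      V∈ = subst (λ b → M 2 (s * P * T p b - K * (1ℚ - u * L i))) u-1-v (T-odd i u∈ 2i<p)

      -- The last step down, to a - 1, is kept apart from `T-odd`: its coefficients a + 1 and 4a
      -- give the factor (a + 1)/a of the claim.
      E∈ : M 2 ((a + 1ℚ) * τ + ℕ→ℚ 4 * a * τ')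
      E∈ = M-resp
        (cong₂ _+_ (cong₂ (λ b c → b * T p c) (plus2 a) (plus11 a)) (cong (λ b → ℕ→ℚ 4 * b * τ') (plus1 a)))
        (T-step {a - 1ℚ} {double m} (residue (M-resp
            (trans (cong (λ k → a - k) (ℕ→ℚ-suc (double m))) (shift a (ℕ→ℚ (double m)))) a≡r′)) r+2≤p)
        where
        plus2 : ∀ a → a - 1ℚ + ℕ→ℚ 2 ≡ a + 1ℚ
        plus2 = solve-∀ ℚ-ring
        plus11 : ∀ a → a - 1ℚ + 1ℚ + 1ℚ ≡ a + 1ℚ
        plus11 = solve-∀ ℚ-ring
        plus1 : ∀ a → a - 1ℚ + 1ℚ ≡ a
        plus1 = solve-∀ ℚ-ring
        shift : ∀ a k → a - (1ℚ + k) ≡ a - 1ℚ - k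
        shift = solve-∀ ℚ-ring

      -- As p - 1 = r + 1 + 2i, the exponents add up to 2(p - 1): hence 1/(2 · 16^i) is 2^(2r+1)
      -- divided by the square of 2^(p-1) = 1 + p q_p(2).
      2PZ : ℕ→ℚ 2 * P * Z ≡ (1ℚ + x) * (1ℚ + x)
      2PZ = begin
        ℕ→ℚ 2 * P * Z
          ≡⟨ cong (_* Z) (ℕ→ℚ-* 2 (2 ℕ.^ (2 ℕ.* double i))) ⟨
        ℕ→ℚ (2 ℕ.^ suc (2 ℕ.* double i)) * Z
          ≡⟨ ℕ→ℚ-* (2 ℕ.^ suc (2 ℕ.* double i)) (2 ℕ.^ (2 ℕ.* r ℕ.+ 1)) ⟨
        ℕ→ℚ (2 ℕ.^ suc (2 ℕ.* double i) ℕ.* 2 ℕ.^ (2 ℕ.* r ℕ.+ 1))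
          ≡⟨ cong ℕ→ℚ (ℕₚ.^-distribˡ-+-* 2 (suc (2 ℕ.* double i)) (2 ℕ.* r ℕ.+ 1)) ⟨
        ℕ→ℚ (2 ℕ.^ (suc (2 ℕ.* double i) ℕ.+ (2 ℕ.* r ℕ.+ 1)))
          ≡⟨ cong (λ k → ℕ→ℚ (2 ℕ.^ k)) exponents ⟩
        ℕ→ℚ (2 ℕ.^ ((p ∸ 1) ℕ.+ (p ∸ 1)))
          ≡⟨ cong ℕ→ℚ (ℕₚ.^-distribˡ-+-* 2 (p ∸ 1) (p ∸ 1)) ⟩
        ℕ→ℚ (2 ℕ.^ (p ∸ 1) ℕ.* 2 ℕ.^ (p ∸ 1))
          ≡⟨ ℕ→ℚ-* (2 ℕ.^ (p ∸ 1)) (2 ℕ.^ (p ∸ 1)) ⟩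
        ℕ→ℚ (2 ℕ.^ (p ∸ 1)) * ℕ→ℚ (2 ℕ.^ (p ∸ 1))
          ≡⟨ cong (λ y → y * y) 2^p-1 ⟩
        (1ℚ + x) * (1ℚ + x) ∎
        where
        sum : ∀ m i → suc (2 ℕ.* (2 ℕ.* i)) ℕ.+ (2 ℕ.* suc (2 ℕ.* m) ℕ.+ 1) ≡ 2 ℕ.* (suc m ℕ.+ i) ℕ.+ 2 ℕ.* (suc m ℕ.+ i)
        sum = ℕ-Solver.solve-∀
        exponents : suc (2 ℕ.* double i) ℕ.+ (2 ℕ.* r ℕ.+ 1) ≡ (p ∸ 1) ℕ.+ (p ∸ 1)
        exponents = trans (cong₂ (λ j k → suc (2 ℕ.* j) ℕ.+ (2 ℕ.* suc k ℕ.+ 1)) (double≡2* i) (double≡2* m))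
          (trans (sum m i) (sym (cong (λ k → k ℕ.+ k) (trans p-1≡2n (double≡2* n)))))
        2^p-1 : ℕ→ℚ (2 ℕ.^ (p ∸ 1)) ≡ 1ℚ + x
        2^p-1 = trans (restore (ℕ→ℚ (2 ℕ.^ (p ∸ 1)))) (cong (λ y → 1ℚ + y) (sym π*qp2))
          where
          restore : ∀ y → y ≡ 1ℚ + (y - 1ℚ)
          restore = solve-∀ ℚ-ring

      U-unit : Unit (ℕ→ℚ 2 * a * P)
      U-unit = Unit-* (Unit-* (Unit-inv 2<p) a-unit) (Unit-2^ (2 ℕ.* double i) 2<p)

      Q = ℕ→ℚ 2 * a * P * (S a - ℕ→ℚ 2 * τ') + P * ((a + 1ℚ) * τ + ℕ→ℚ 4 * a * τ')
        - (a + 1ℚ) * s * (s * P * τ - K * (1ℚ - u * L i))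

      -- The factor 1 - 2p q_p(2) inverts that square to first order: (1 + x)²(1 - 2x) = 1 - 3x² -
      -- 2x³, and p divides x.
      identity : ℕ→ℚ 2 * a * P * (S a - ((a + 1ℚ) ÷₀ a) * (- 1ℚ * s) * Z * K * (1ℚ - ℕ→ℚ 2 * π * qp2 p + u * κ))
        ≡ Q + (a + 1ℚ) * s * K * (u * (κ + L i) + x * u * (ℕ→ℚ 2 * κ) + x * x * (u * κ - ℕ→ℚ 2 * x - ℕ→ℚ 3))
      identity = begin
        ℕ→ℚ 2 * a * P * (S a - ((a + 1ℚ) ÷₀ a) * (- 1ℚ * s) * Z * K * (1ℚ - ℕ→ℚ 2 * π * qp2 p + u * κ))
          ≡⟨ cong₂ (λ y z → ℕ→ℚ 2 * a * P * (S a - y * (- 1ℚ * s) * Z * K * (1ℚ - z + u * κ)))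
               (÷₀-* (a + 1ℚ) a a⁻¹ (Unit.*-inverse a-unit)) (ℚₚ.*-assoc (ℕ→ℚ 2) π (qp2 p)) ⟩
        ℕ→ℚ 2 * a * P * (S a - (a + 1ℚ) * a⁻¹ * (- 1ℚ * s) * Z * K * (1ℚ - ℕ→ℚ 2 * x + u * κ))
          ≡⟨ eliminate a P (S a) s K τ τ' (1ℚ - u * L i) ((a + 1ℚ) * a⁻¹ * (- 1ℚ * s) * Z * K * w) ⟩
        Q + (s * s - 1ℚ) * ((a + 1ℚ) * P * τ)
          + (- (ℕ→ℚ 2 * a * P * ((a + 1ℚ) * a⁻¹ * (- 1ℚ * s) * Z * K * w)) - (a + 1ℚ) * s * K * (1ℚ - u * L i))
          ≡⟨ cong (λ y → Q + (s * s - 1ℚ) * ((a + 1ℚ) * P * τ) + y) (factor a (a + 1ℚ) P a⁻¹ s Z K w (1ℚ - u * L i)) ⟩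
        Q + (s * s - 1ℚ) * ((a + 1ℚ) * P * τ)
          + (a + 1ℚ) * s * K * (a * a⁻¹ * (ℕ→ℚ 2 * P * Z) * (1ℚ - ℕ→ℚ 2 * x + u * κ) - (1ℚ - u * L i))
          ≡⟨ cong₂ (λ y z → Q + (y - 1ℚ) * ((a + 1ℚ) * P * τ) + (a + 1ℚ) * s * K * (z * (1ℚ - ℕ→ℚ 2 * x + u * κ) - (1ℚ - u * L i)))
               (-1^-square i) (cong₂ _*_ (Unit.*-inverse a-unit) 2PZ) ⟩
        Q + (1ℚ - 1ℚ) * ((a + 1ℚ) * P * τ)
          + (a + 1ℚ) * s * K * (1ℚ * ((1ℚ + x) * (1ℚ + x)) * (1ℚ - ℕ→ℚ 2 * x + u * κ) - (1ℚ - u * L i))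
          ≡⟨ collect Q ((a + 1ℚ) * P * τ) ((a + 1ℚ) * s * K) x u κ (L i) ⟩
        Q + (a + 1ℚ) * s * K * (u * (κ + L i) + x * u * (ℕ→ℚ 2 * κ) + x * x * (u * κ - ℕ→ℚ 2 * x - ℕ→ℚ 3)) ∎
        where
        w = 1ℚ - ℕ→ℚ 2 * x + u * κ
        eliminate : ∀ a P S s K τ τ' l N →
          ℕ→ℚ 2 * a * P * (S - N)
          ≡ ℕ→ℚ 2 * a * P * (S - ℕ→ℚ 2 * τ') + P * ((a + 1ℚ) * τ + ℕ→ℚ 4 * a * τ') - (a + 1ℚ) * s * (s * P * τ - K * l)
            + (s * s - 1ℚ) * ((a + 1ℚ) * P * τ)
            + (- (ℕ→ℚ 2 * a * P * N) - (a + 1ℚ) * s * K * l)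
        eliminate = solve-∀ ℚ-ring
        factor : ∀ a b P i s Z K w l →
          - (ℕ→ℚ 2 * a * P * (b * i * (- 1ℚ * s) * Z * K * w)) - b * s * K * l
          ≡ b * s * K * (a * i * (ℕ→ℚ 2 * P * Z) * w - l)
        factor = solve-∀ ℚ-ring
        collect : ∀ Q y k x u κ l →
          Q + (1ℚ - 1ℚ) * y + k * (1ℚ * ((1ℚ + x) * (1ℚ + x)) * (1ℚ - ℕ→ℚ 2 * x + u * κ) - (1ℚ - u * l))
          ≡ Q + k * (u * (κ + l) + x * u * (ℕ→ℚ 2 * κ) + x * x * (u * κ - ℕ→ℚ 2 * x - ℕ→ℚ 3))
        collect = solve-∀ ℚ-ring

-- Parity and the passage to the stated form

parity : ∀ k → (∃[ n ] k ≡ double n) ⊎ (∃[ n ] k ≡ suc (double n))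
parity zero = inj₁ (0 , refl)
parity (suc k) with parity k
... | inj₁ (n , refl) = inj₂ (n , refl)
... | inj₂ (n , refl) = inj₁ (suc n , refl)

odd-prime : ∀ {p} → Prime p → p ≢ 2 → ∃[ n ] p ≡ suc (double n)
odd-prime {p} p-prime p≢2 with parity p
... | inj₂ odd = odd
... | inj₁ (n , p≡2n) with prime⇒irreducible p-prime (divides n (trans p≡2n (trans (double≡2* n) (ℕₚ.*-comm 2 n))))
...   | inj₁ ()
...   | inj₂ 2≡p = ⊥-elim (p≢2 (sym 2≡p))

theorem3p3 : (p : ℕ) → Prime p → p ≢ 2 → (a : ℚ) → InZp p a →
    ¬ (a ≡ 0ℚ [mod p ^ 1 ]) → ¬ (a ≡ - 1ℚ [mod p ^ 1 ]) →
    (r : ℕ) → r < p → a ≡ ℕ→ℚ r [mod p ^ 1 ] →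
    ((m : ℕ) → r ≡ 2 ℕ.* m →
    Σ< p (λ k → binom a k * binom a k * ((- 1ℚ) ^ℚ k)
    * (1ℚ - (ℕ→ℚ 2 ÷₀ a) * ℕ→ℚ k))
    ≡ ((- 1ℚ) ^ℚ (r / 2)) * ℕ→ℚ (2 ℕ.^ (2 ℕ.* r))
    * ((a - ℕ→ℚ r) ÷₀ (a * ℕ→ℚ (r C (r / 2))))
    [mod p ^ 2 ])
    ×
    ((m : ℕ) → r ≡ 1 ℕ.+ 2 ℕ.* m →
    Σ< p (λ k → binom a k * binom a k * ((- 1ℚ) ^ℚ k)
    * (1ℚ - (ℕ→ℚ 2 ÷₀ a) * ℕ→ℚ k))
    ≡ ((a + 1ℚ) ÷₀ a) * ((- 1ℚ) ^ℚ ((p ∸ r) / 2))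
    * ℕ→ℚ (2 ℕ.^ (2 ℕ.* r ℕ.+ 1))
    * ℕ→ℚ ((p ∸ 2 ∸ r) C ((p ∸ 2 ∸ r) / 2))
    * (1ℚ - ℕ→ℚ 2 * ℕ→ℚ p * qp2 p
    + (ℕ→ℚ p + a - ℕ→ℚ r) * (H (r ℕ.+ 1) - H ((r ℕ.+ 1) / 2)))
    [mod p ^ 2 ])
theorem3p3 p p-prime p≢2 a a∈Zp a≢0 _ r r<p a≡r =
  (λ m r≡2m → even r r<p a≡r m (trans r≡2m (sym (double≡2* m)))) ,
  (λ m r≡1+2m → odd r r<p a≡r m (trans r≡1+2m (cong suc (sym (double≡2* m)))))
  where
  open Localisation p p-prime
  open Congruences p p-prime
  M⇒mod : ∀ {k d} → M k d → ∃[ z ] (InZp p z × d ≡ ℕ→ℚ (p ℕ.^ k) * z)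
  M⇒mod (mkM z (zp hz) eq) = z , hz , eq

  mod⇒Residue : ∀ {b n} → b ≡ ℕ→ℚ n [mod p ^ 1 ] → Residue b n
  mod⇒Residue (z , hz , eq) = residue (mkM z (zp hz) eq)

  a-unit : Unit a
  a-unit = ∉M1⇒Unit (zp a∈Zp) (λ a∈M1 → a≢0 (M⇒mod (M-resp (sym (ℚₚ.+-identityʳ a)) a∈M1)))

  even : ∀ r → r < p → a ≡ ℕ→ℚ r [mod p ^ 1 ] → (m : ℕ) → r ≡ double m →
    S a ≡ -1^ (r / 2) * ℕ→ℚ (2 ℕ.^ (2 ℕ.* r)) * ((a - ℕ→ℚ r) ÷₀ (a * ℕ→ℚ (r C (r / 2)))) [mod p ^ 2 ]
  even r r<p a≡r zero    refl = ⊥-elim (a≢0 a≡r)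
  even r r<p a≡r (suc j) refl = M⇒mod (subst
    (λ h → M 2 (S a - -1^ h * 16^ (suc j) * ((a - ℕ→ℚ r) ÷₀ (a * ℕ→ℚ (r C h)))))
    (sym (double/2 (suc j)))
    (subst (λ c → M 2 (S a - -1^ (suc j) * 16^ (suc j) * ((a - ℕ→ℚ r) ÷₀ (a * c))))
      (binom-ℕ r (suc j)) (even-case a-unit j r<p (mod⇒Residue a≡r))))

  odd : ∀ r → r < p → a ≡ ℕ→ℚ r [mod p ^ 1 ] → (m : ℕ) → r ≡ suc (double m) →
    S a ≡ ((a + 1ℚ) ÷₀ a) * -1^ ((p ∸ r) / 2)
      * ℕ→ℚ (2 ℕ.^ (2 ℕ.* r ℕ.+ 1))
      * ℕ→ℚ ((p ∸ 2 ∸ r) C ((p ∸ 2 ∸ r) / 2))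
      * (1ℚ - ℕ→ℚ 2 * ℕ→ℚ p * qp2 p
         + (ℕ→ℚ p + a - ℕ→ℚ r) * (H (r ℕ.+ 1) - H ((r ℕ.+ 1) / 2))) [mod p ^ 2 ]
  odd r r<p a≡r m refl = M⇒mod (M-resp (sym (cong₂ (λ x y → S a - x * (1ℚ - ℕ→ℚ 2 * π * qp2 p + (π + a - ℕ→ℚ r) * y)) factors harmonic))
          (odd-case a-unit m i p≡ (mod⇒Residue a≡r)))
    where
    n = proj₁ (odd-prime p-prime p≢2)
    p≡1+2n : p ≡ suc (double n)
    p≡1+2n = proj₂ (odd-prime p-prime p≢2)
    m<n : m < n
    m<n = ℕₚ.*-cancelˡ-< 2 m n (subst₂ _<_ (double≡2* m) (double≡2* n) (ℕₚ.≤-pred (subst (suc (double m) <_) p≡1+2n r<p)))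
    -- Both r and p are odd and r < p, so m < n and the truncated subtraction is exact; i counts the
    -- steps of descent, with p - r = 2(i + 1).
    i = n ∸ suc m
    p≡ : p ≡ suc (double (suc m ℕ.+ i))
    p≡ = trans p≡1+2n (cong (λ k → suc (double k)) (sym (ℕₚ.m+[n∸m]≡n m<n)))
    p≡r+2[i+1] : p ≡ r ℕ.+ double (suc i)
    p≡r+2[i+1] = trans p≡ (cong suc (trans (cong double (sym (ℕₚ.+-suc m i))) (double-+ m (suc i))))
    p∸r : p ∸ r ≡ double (suc i)
    p∸r = trans (cong (_∸ r) p≡r+2[i+1]) (ℕₚ.m+n∸m≡n r (double (suc i)))
    p∸2∸r : p ∸ 2 ∸ r ≡ double i
    p∸2∸r = trans (ℕₚ.∸-+-assoc p 2 r) (trans (cong (p ∸_) (ℕₚ.+-comm 2 r)) (trans (sym (ℕₚ.∸-+-assoc p r 2)) (cong (_∸ 2) p∸r)))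
    r+1 : r ℕ.+ 1 ≡ double (suc m)
    r+1 = ℕₚ.+-comm r 1
    factors : ((a + 1ℚ) ÷₀ a) * -1^ ((p ∸ r) / 2) * ℕ→ℚ (2 ℕ.^ (2 ℕ.* r ℕ.+ 1)) * ℕ→ℚ ((p ∸ 2 ∸ r) C ((p ∸ 2 ∸ r) / 2))
      ≡ ((a + 1ℚ) ÷₀ a) * -1^ (suc i) * ℕ→ℚ (2 ℕ.^ (2 ℕ.* r ℕ.+ 1)) * central i
    factors = cong₂ (λ h c → ((a + 1ℚ) ÷₀ a) * -1^ h * ℕ→ℚ (2 ℕ.^ (2 ℕ.* r ℕ.+ 1)) * c)
      (trans (cong (_/ 2) p∸r) (double/2 (suc i)))
      (trans (cong (λ k → ℕ→ℚ (k C (k / 2))) p∸2∸r)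
        (trans (cong (λ k → ℕ→ℚ (double i C k)) (double/2 i)) (sym (binom-ℕ (double i) i))))
    harmonic : H (r ℕ.+ 1) - H ((r ℕ.+ 1) / 2) ≡ H (double (suc m)) - H (suc m)
    harmonic = trans (cong (λ k → H k - H (k / 2)) r+1) (cong (λ k → H (double (suc m)) - H k) (double/2 (suc m)))
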